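{- Let $\Theta$ be a set of formulas of first-order arithmetic. If there is a $\mathrm{CHA}$-proof of $\Gamma\Rightarrow\delta$ in which every bud and every companion is labelled by a sequent $\Gamma'\Rightarrow\delta'$ with $\Gamma'\cup\{\delta'\}\subseteq\Theta$, then there is an $\mathrm{HA}$-proof of $\Gamma\Rightarrow\delta$ in which every instance $\varphi(0),\forall x.\,\varphi(x)\to\varphi(Sx)\Rightarrow\varphi(s)$ of the induction axioms has $\varphi\in\Pi(\Theta\Rightarrow\Theta)$ or $\varphi$ a $\Delta_0$ (bounded) formula.
   Context: Language: terms from variables, $0,S,+,\cdot$; formulas from $s=t,\bot,\wedge,\vee,\to,\forall,\exists$. Abbreviations: $x<y:=\exists z.\,y=x+Sz$, $x\le y:=x<Sy$, $\forall x<t.\varphi:=\forall x.(x<t\to\varphi)$, $\exists x<t.\varphi:=\exists x.(x<t\wedge\varphi)$. Sequents $\Gamma\Rightarrow\delta$: finite set $\Gamma$, single formula $\delta$. $\mathrm{HA}$: sequent calculus with the standard intuitionistic rules (Ax, $\to$L/R, $\wedge$L/R, $\vee$L/R, $\forall$L/R, $\exists$L/R, $\bot$L, $=$L, $=$R), weakening, cut, arithmetic axioms ($\Rightarrow 0\neq St$, $Ss=St\Rightarrow s=t$, $\Rightarrow s+0=s$, $\Rightarrow s+St=S(s+t)$, $\Rightarrow s\cdot0=0$, $\Rightarrow s\cdot St=(s\cdot t)+s$) and induction axioms $\varphi(0),\forall x.\,\varphi(x)\to\varphi(Sx)\Rightarrow\varphi(s)$; proofs are finite trees. $\mathrm{CHA}$: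 rules of $\mathrm{HA}$ without induction axioms plus $\textsc{Case}_x$ (from $\Gamma[0/x]\Rightarrow\delta[0/x]$ and $\Gamma[Sx/x]\Rightarrow\delta[Sx/x]$ infer $\Gamma\Rightarrow\delta$). Pre-proofs are finite trees with a partial map $\beta$ sending some leaves (buds) to inner nodes (companions), non-bud nodes labelled by rule instances, each bud carrying its companion's sequent. An infinite branch starts at the root and moves to a child or from a bud to its companion. A $\mathrm{CHA}$-proof is a pre-proof such that along every infinite branch some variable $x$ is, from some point on, free in every sequent and the branch passes instances of $\textsc{Case}_x$ infinitely often. Operations on sets of formulas: $\Theta\Rightarrow\Theta:=\{(\bigwedge\Phi)\to\psi \mid \Phi\subseteq\Theta \text{ finite},\ \psi\in\Theta\}$; $\Pi(\Theta)$ is the smallest set of formulas containing $\Theta$ and closed under bounded quantification ($\varphi\in\Pi(\Theta)$, $t$ a term not containing $x$ imply $\forall x<t.\varphi,\exists x<t.\varphi\in\Pi(\Theta)$) and under unbounded universal quantification. -}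

module Defs where

open import Data.Nat using (ℕ; zero; suc; _≤_; _≡ᵇ_)
open import Data.Fin using (Fin; zero; suc)
open import Data.Bool using (Bool; true; false; if_then_else_; _∨_)
open import Data.List using (List; []; _∷_; map; _∷ʳ_)
open import Data.List.Relation.Unary.All using (All; []; _∷_)
open import Data.List.Relation.Binary.Subset.Propositional using (_⊆_)
open import Data.Maybe using (Maybe; just; nothing)
open import Data.Product using (Σ; _×_; _,_)
open import Data.Sum using (_⊎_)
open import Relation.Binary.PropositionalEquality using (_≡_; _≢_)

-- Syntax of first-order arithmetic (locally nameless).
-- Free variables are names  var x  (x : ℕ).  Bound variables are
-- de Bruijn LEVELS  bv i  (i : Fin n), where n is the number of
-- enclosing binders; level 0 is the outermost binder.
-- Formula 0 / Term 0 are the ordinary formulas / terms (all variables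
-- free are names); no variable capture can occur.

data Term (n : ℕ) : Set where
  var  : ℕ → Term n
  bv   : Fin n → Term n
  `0   : Term n
  `S   : Term n → Term n
  _`+_ : Term n → Term n → Term n
  _`·_ : Term n → Term n → Term n

infix  4 _≐_
infixr 3 _`∧_
infixr 2 _`∨_
infixr 1 _⊃_

data Formula (n : ℕ) : Set where
  _≐_  : Term n → Term n → Formula n
  `⊥   : Formula n
  _`∧_ : Formula n → Formula n → Formula n
  _`∨_ : Formula n → Formula n → Formula n
  _⊃_  : Formula n → Formula n → Formula n
  `∀   : Formula (suc n) → Formula n
  `∃   : Formula (suc n) → Formula n

wkT : ∀ {n} → Term 0 → Term n
wkT (var x)   = var x
wkT (bv ())
wkT `0        = `0
wkT (`S t)    = `S (wkT t)
wkT (s `+ t)  = wkT s `+ wkT t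
wkT (s `· t)  = wkT s `· wkT t

substT : ∀ {n} → ℕ → Term 0 → Term n → Term n
substT x u (var y)  = if x ≡ᵇ y then wkT u else var y
substT x u (bv i)   = bv i
substT x u `0       = `0
substT x u (`S t)   = `S (substT x u t)
substT x u (s `+ t) = substT x u s `+ substT x u t
substT x u (s `· t) = substT x u s `· substT x u t

substF : ∀ {n} → ℕ → Term 0 → Formula n → Formula n
substF x u (s ≐ t)  = substT x u s ≐ substT x u t
substF x u `⊥       = `⊥
substF x u (φ `∧ ψ) = substF x u φ `∧ substF x u ψ
substF x u (φ `∨ ψ) = substF x u φ `∨ substF x u ψ
substF x u (φ ⊃ ψ)  = substF x u φ ⊃ substF x u ψ
substF x u (`∀ φ)   = `∀ (substF x u φ)
substF x u (`∃ φ)   = `∃ (substF x u φ)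

openT : ∀ {n} → Term 0 → Term (suc n) → Term n
openT u (var y)      = var y
openT u (bv zero)    = wkT u
openT u (bv (suc i)) = bv i
openT u `0           = `0
openT u (`S t)       = `S (openT u t)
openT u (s `+ t)     = openT u s `+ openT u t
openT u (s `· t)     = openT u s `· openT u t

openF : ∀ {n} → Term 0 → Formula (suc n) → Formula n
openF u (s ≐ t)  = openT u s ≐ openT u t
openF u `⊥       = `⊥
openF u (φ `∧ ψ) = openF u φ `∧ openF u ψ
openF u (φ `∨ ψ) = openF u φ `∨ openF u ψ
openF u (φ ⊃ ψ)  = openF u φ ⊃ openF u ψ
openF u (`∀ φ)   = `∀ (openF u φ)
openF u (`∃ φ)   = `∃ (openF u φ)

closeT : ∀ {n} → ℕ → Term n → Term (suc n)
closeT x (var y)  = if x ≡ᵇ y then bv zero else var y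
closeT x (bv i)   = bv (suc i)
closeT x `0       = `0
closeT x (`S t)   = `S (closeT x t)
closeT x (s `+ t) = closeT x s `+ closeT x t
closeT x (s `· t) = closeT x s `· closeT x t

closeF : ∀ {n} → ℕ → Formula n → Formula (suc n)
closeF x (s ≐ t)  = closeT x s ≐ closeT x t
closeF x `⊥       = `⊥
closeF x (φ `∧ ψ) = closeF x φ `∧ closeF x ψ
closeF x (φ `∨ ψ) = closeF x φ `∨ closeF x ψ
closeF x (φ ⊃ ψ)  = closeF x φ ⊃ closeF x ψ
closeF x (`∀ φ)   = `∀ (closeF x φ)
closeF x (`∃ φ)   = `∃ (closeF x φ)

all[_]_ : ℕ → Formula 0 → Formula 0
all[ x ] φ = `∀ (closeF x φ)

ex[_]_ : ℕ → Formula 0 → Formula 0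
ex[ x ] φ = `∃ (closeF x φ)

freeT : ∀ {n} → ℕ → Term n → Bool
freeT x (var y)  = x ≡ᵇ y
freeT x (bv i)   = false
freeT x `0       = false
freeT x (`S t)   = freeT x t
freeT x (s `+ t) = freeT x s ∨ freeT x t
freeT x (s `· t) = freeT x s ∨ freeT x t

freeF : ∀ {n} → ℕ → Formula n → Bool
freeF x (s ≐ t)  = freeT x s ∨ freeT x t
freeF x `⊥       = false
freeF x (φ `∧ ψ) = freeF x φ ∨ freeF x ψ
freeF x (φ `∨ ψ) = freeF x φ ∨ freeF x ψ
freeF x (φ ⊃ ψ)  = freeF x φ ∨ freeF x ψ
freeF x (`∀ φ)   = freeF x φ
freeF x (`∃ φ)   = freeF x φ

freeL : ℕ → List (Formula 0) → Bool
freeL x []      = false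
freeL x (φ ∷ Γ) = freeF x φ ∨ freeL x Γ

`¬_ : Formula 0 → Formula 0
`¬ φ = φ ⊃ `⊥

`⊤ : Formula 0
`⊤ = `⊥ ⊃ `⊥

_`<_ : Term 0 → Term 0 → Formula 0
s `< t = `∃ (wkT t ≐ wkT s `+ `S (bv zero))

ball : ℕ → Term 0 → Formula 0 → Formula 0
ball x t φ = all[ x ] ((var x `< t) ⊃ φ)

bex : ℕ → Term 0 → Formula 0 → Formula 0
bex x t φ = ex[ x ] ((var x `< t) `∧ φ)

⋀ : List (Formula 0) → Formula 0
⋀ []          = `⊤
⋀ (φ ∷ [])    = φ
⋀ (φ ∷ ψ ∷ Φ) = φ `∧ ⋀ (ψ ∷ Φ)

data ImpSet (Θ : Formula 0 → Set) : Formula 0 → Set where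
  imp : (Φ : List (Formula 0)) (ψ : Formula 0) →
        All Θ Φ → Θ ψ → ImpSet Θ (⋀ Φ ⊃ ψ)

data Pi (Θ : Formula 0 → Set) : Formula 0 → Set where
  base  : ∀ {φ} → Θ φ → Pi Θ φ
  pball : ∀ {φ} (x : ℕ) (t : Term 0) → freeT x t ≡ false →
          Pi Θ φ → Pi Θ (ball x t φ)
  pbex  : ∀ {φ} (x : ℕ) (t : Term 0) → freeT x t ≡ false →
          Pi Θ φ → Pi Θ (bex x t φ)
  pall  : ∀ {φ} (x : ℕ) → Pi Θ φ → Pi Θ (all[ x ] φ)

data Δ0 : Formula 0 → Set where
  eq   : (s t : Term 0) → Δ0 (s ≐ t)
  lt   : (s t : Term 0) → Δ0 (s `< t)
  bot  : Δ0 `⊥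
  and  : ∀ {φ ψ} → Δ0 φ → Δ0 ψ → Δ0 (φ `∧ ψ)
  or   : ∀ {φ ψ} → Δ0 φ → Δ0 ψ → Δ0 (φ `∨ ψ)
  imp  : ∀ {φ ψ} → Δ0 φ → Δ0 ψ → Δ0 (φ ⊃ ψ)
  dball : ∀ {φ} (x : ℕ) (t : Term 0) → freeT x t ≡ false →
          Δ0 φ → Δ0 (ball x t φ)
  dbex  : ∀ {φ} (x : ℕ) (t : Term 0) → freeT x t ≡ false →
          Δ0 φ → Δ0 (bex x t φ)

-- Sequents  Γ ⇒ δ  (Γ a finite set, represented by a list; the
-- weakening rule below is stated with list inclusion, so exchange and
-- contraction are admissible exactly as for sets)

infix 0 _⇒_
record Seq : Set where
  constructor _⇒_
  field
    ctx  : List (Formula 0)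
    goal : Formula 0
open Seq public

freeSeq : ℕ → Seq → Bool
freeSeq x (Γ ⇒ δ) = freeL x Γ ∨ freeF x δ

substSeq : ℕ → Term 0 → Seq → Seq
substSeq x u (Γ ⇒ δ) = map (substF x u) Γ ⇒ substF x u δ

data Rule : List Seq → Seq → Set where
  ax    : ∀ {Γ φ} → Rule [] (φ ∷ Γ ⇒ φ)
  wk    : ∀ {Γ Δ δ} → Γ ⊆ Δ → Rule ((Γ ⇒ δ) ∷ []) (Δ ⇒ δ)
  cut   : ∀ {Γ φ δ} → Rule ((Γ ⇒ φ) ∷ (φ ∷ Γ ⇒ δ) ∷ []) (Γ ⇒ δ)
  ⊥L    : ∀ {Γ δ} → Rule [] (`⊥ ∷ Γ ⇒ δ)
  ∧L    : ∀ {Γ φ ψ δ} → Rule ((φ ∷ ψ ∷ Γ ⇒ δ) ∷ []) ((φ `∧ ψ) ∷ Γ ⇒ δ)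
  ∧R    : ∀ {Γ φ ψ} → Rule ((Γ ⇒ φ) ∷ (Γ ⇒ ψ) ∷ []) (Γ ⇒ φ `∧ ψ)
  ∨L    : ∀ {Γ φ ψ δ} →
          Rule ((φ ∷ Γ ⇒ δ) ∷ (ψ ∷ Γ ⇒ δ) ∷ []) ((φ `∨ ψ) ∷ Γ ⇒ δ)
  ∨R₁   : ∀ {Γ φ ψ} → Rule ((Γ ⇒ φ) ∷ []) (Γ ⇒ φ `∨ ψ)
  ∨R₂   : ∀ {Γ φ ψ} → Rule ((Γ ⇒ ψ) ∷ []) (Γ ⇒ φ `∨ ψ)
  ⊃L    : ∀ {Γ φ ψ δ} →
          Rule ((Γ ⇒ φ) ∷ (ψ ∷ Γ ⇒ δ) ∷ []) ((φ ⊃ ψ) ∷ Γ ⇒ δ)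
  ⊃R    : ∀ {Γ φ ψ} → Rule ((φ ∷ Γ ⇒ ψ) ∷ []) (Γ ⇒ φ ⊃ ψ)
  ∀L    : ∀ {Γ φ δ} (t : Term 0) →
          Rule ((openF t φ ∷ Γ ⇒ δ) ∷ []) (`∀ φ ∷ Γ ⇒ δ)
  ∀R    : ∀ {Γ φ} (y : ℕ) → freeL y Γ ≡ false → freeF y (`∀ φ) ≡ false →
          Rule ((Γ ⇒ openF (var y) φ) ∷ []) (Γ ⇒ `∀ φ)
  ∃L    : ∀ {Γ φ δ} (y : ℕ) → freeL y Γ ≡ false → freeF y (`∃ φ) ≡ false →
          freeF y δ ≡ false →
          Rule ((openF (var y) φ ∷ Γ ⇒ δ) ∷ []) (`∃ φ ∷ Γ ⇒ δ)
  ∃R    : ∀ {Γ φ} (t : Term 0) → Rule ((Γ ⇒ openF t φ) ∷ []) (Γ ⇒ `∃ φ)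
  =R    : ∀ {Γ} (t : Term 0) → Rule [] (Γ ⇒ t ≐ t)
  =L    : ∀ {Γ δ} (x : ℕ) (s t : Term 0) →
          Rule ((map (substF x t) Γ ⇒ substF x t δ) ∷ [])
               ((s ≐ t) ∷ map (substF x s) Γ ⇒ substF x s δ)
  zeroS : (t : Term 0) → Rule [] ([] ⇒ `¬ (`0 ≐ `S t))
  injS  : (s t : Term 0) → Rule [] ((`S s ≐ `S t) ∷ [] ⇒ s ≐ t)
  plus0 : (s : Term 0) → Rule [] ([] ⇒ s `+ `0 ≐ s)
  plusS : (s t : Term 0) → Rule [] ([] ⇒ s `+ `S t ≐ `S (s `+ t))
  times0 : (s : Term 0) → Rule [] ([] ⇒ s `· `0 ≐ `0)
  timesS : (s t : Term 0) → Rule [] ([] ⇒ s `· `S t ≐ (s `· t) `+ s)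

IndAx : ℕ → Formula 0 → Term 0 → Seq
IndAx x φ s =
  substF x `0 φ ∷ (all[ x ] (φ ⊃ substF x (`S (var x)) φ)) ∷ [] ⇒ substF x s φ

data HAProof (P : Formula 0 → Set) : Seq → Set where
  rule : ∀ {ps s} → Rule ps s → All (HAProof P) ps → HAProof P s
  ind  : (x : ℕ) (φ : Formula 0) (s : Term 0) → P φ →
         HAProof P (IndAx x φ s)

data CRule : List Seq → Seq → Set where
  base : ∀ {ps s} → Rule ps s → CRule ps s
  case : ∀ {Γ δ} (x : ℕ) →
         CRule (substSeq x `0 (Γ ⇒ δ) ∷ substSeq x (`S (var x)) (Γ ⇒ δ) ∷ [])
               (Γ ⇒ δ)

caseVar : ∀ {ps s} → CRule ps s → Maybe ℕ
caseVar (base _) = nothing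
caseVar (case x) = just x

-- node addresses: paths of child indices from the root
Address : Set
Address = List ℕ

-- A finite tree; a bud is a leaf carrying the address of its companion
-- (this encodes the partial map β) and labelled with a sequent.
data PT : Seq → Set where
  bud  : (s : Seq) → Address → PT s
  node : ∀ {ps s} → CRule ps s → All PT ps → PT s

Node : Set
Node = Σ Seq PT

mutual
  sub : ∀ {s} → PT s → Address → Maybe Node
  sub {s} t [] = just (s , t)
  sub (bud s c) (i ∷ a) = nothing
  sub (node r ts) (i ∷ a) = subs ts i a

  subs : ∀ {ps} → All PT ps → ℕ → Address → Maybe Node
  subs [] i a = nothing
  subs (t ∷ ts) zero a = sub t a
  subs (t ∷ ts) (suc i) a = subs ts i a

BudAt : ∀ {s} → PT s → Address → Seq → Address → Set
BudAt π a s' c = sub π a ≡ just (s' , bud s' c)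

InnerAt : ∀ {s} → PT s → Address → Seq → Set
InnerAt π a s' = Σ (List Seq) λ ps → Σ (CRule ps s') λ r → Σ (All PT ps) λ ts →
  sub π a ≡ just (s' , node r ts) × ps ≢ []

PreProof : ∀ {s} → PT s → Set
PreProof π = ∀ a s' c → BudAt π a s' c → InnerAt π c s'

data Step {s} (π : PT s) : Address → Address → Set where
  child : ∀ a i (n : Node) → sub π (a ∷ʳ i) ≡ just n → Step π a (a ∷ʳ i)
  back  : ∀ a s' c → BudAt π a s' c → Step π a c

InfBranch : ∀ {s} → PT s → (ℕ → Address) → Set
InfBranch π b = b 0 ≡ [] × (∀ n → Step π (b n) (b (suc n)))

FreeAt : ∀ {s} → PT s → ℕ → Address → Set
FreeAt π x a = Σ Node λ n → sub π a ≡ just n × freeSeq x (Data.Product.proj₁ n) ≡ true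

CaseAt : ∀ {s} → PT s → ℕ → Address → Set
CaseAt π x a = Σ Seq λ s' → Σ (List Seq) λ ps → Σ (CRule ps s') λ r →
  Σ (All PT ps) λ ts → sub π a ≡ just (s' , node r ts) × caseVar r ≡ just x

CHAProof : ∀ {s} → PT s → Set
CHAProof π = PreProof π ×
  (∀ b → InfBranch π b →
     Σ ℕ λ x → (Σ ℕ λ N → ∀ n → N ≤ n → FreeAt π x (b n)) ×
               (∀ M → Σ ℕ λ n → M ≤ n × CaseAt π x (b n)))

SeqIn : (Formula 0 → Set) → Seq → Set
SeqIn Θ (Γ ⇒ δ) = All Θ Γ × Θ δ

BudsCompanionsIn : ∀ {s} → (Formula 0 → Set) → PT s → Set
BudsCompanionsIn Θ π = ∀ a s' c → BudAt π a s' c →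
  SeqIn Θ s' × (∀ (n : Node) → sub π c ≡ just n → SeqIn Θ (Data.Product.proj₁ n))

{-# OPTIONS --safe #-}

-- The trace condition on the finite graph of proof nodes amounts to a certificate (Descent): every
-- node carries a stack of entries (n , m), n a rank and m possibly a variable, such that along
-- every edge, at the first level where the stacks are not merely kept, either the rank drops or
-- the variable passes a Case, all variables of the outer levels being free at both ends.  Such
-- stacks arise by repeatedly choosing a strongly connected component C: the branch that cycles
-- through all of C yields its variable x, and the edges leaving the nodes Case x of C are removed.
--
-- Given the stacks, the companions sharing a stack prefix that ends in x are proved simultaneously
-- by induction on x, the variables of the prefix other than x being parameters and all remaining
-- names being universally closed.  The hypotheses of the outer inductions stay in the context, so
-- no implication enters the induction formulas.  A conjunction of the claims is not in Π(Θ ⇒ Θ)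
-- either: the simultaneous induction is reduced to single inductions bounded by some a, which need
-- ∀x<min(n,a).ψ as induction formula, and min is definable with bounded existential quantifiers.

module Submission where

open import Defs
open import Data.Sum using (_⊎_)
open import Data.Bool as Bool using (Bool; true; false; _∧_; _∨_)
open import Data.Bool.Properties using (T-≡; ∨-identityʳ)
open import Data.Empty using (⊥; ⊥-elim)
open import Data.Fin using (zero; suc)
open import Data.Nat as ℕ using (ℕ; zero; suc; _+_; _≤_; _<_; _⊔_; _≡ᵇ_; s≤s; z≤n)
open import Data.List
  using (List; []; _∷_; map; length; _++_; _∷ʳ_; upTo; concatMap; filter; foldr; _ʳ++_; reverse)
open import Data.List.Membership.DecPropositional ℕ._≟_ using (_∈?_)
open import Data.List.Membership.Propositional using (_∈_; _∉_; lose; find)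
open import Data.List.Membership.Propositional.Properties
  using ( ∈-map⁺; ∈-map⁻; ∈-++⁺ˡ; ∈-++⁺ʳ; ∈-++⁻; ∈-concatMap⁺; ∈-concatMap⁻; ∈-upTo⁺; ∈-upTo⁻
        ; ∈-filter⁺; ∈-filter⁻)
open import Data.List.Properties
  using ( ++-assoc; ++-identityʳ; ∷-injective; ∷-injectiveˡ; ∷-injectiveʳ; ≡-dec; filter-notAll
        ; length-ʳ++; map-++; ʳ++-defn; ʳ++-ʳ++)
open import Data.List.Relation.Binary.Subset.Propositional using (_⊆_)
open import Data.List.Relation.Binary.Subset.Propositional.Properties using (++⁺; ⊆-refl)
open import Data.List.Relation.Unary.All as All using (All; []; _∷_)
open import Data.List.Relation.Unary.Any using (Any; here; there; any?)
open import Data.List.Relation.Unary.Any.Properties using (reverse⁺)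
open import Data.Maybe using (Maybe; just; nothing)
import Data.Maybe.Properties as Maybeₚ
open import Data.Nat.Induction using (<-rec)
open import Data.Nat.Properties as ℕₚ
  using ( ≡ᵇ⇒≡; ≡⇒≡ᵇ; m≤m⊔n; m≤n⊔m; ≤-trans; <-irrefl; ≤-refl; m≤n+m; >⇒≢; m≤n⇒m≤1+n
        ; ≤-antisym; ≤-pred; +-suc; +-identityʳ; +-cancelˡ-≡)
open import Data.Product using (Σ; _×_; _,_; proj₁; proj₂)
import Data.Product.Properties as Productₚ
open import Data.Sum using (inj₁; inj₂)
open import Data.Unit using (⊤; tt)
open import Function using (Equivalence)
open import Relation.Binary using (DecidableEquality)
open import Relation.Binary.Construct.Closure.ReflexiveTransitive using (Star; ε; _◅_; _◅◅_; gmap)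
open import Relation.Binary.Construct.Closure.ReflexiveTransitive.Properties using (◅◅-assoc)
open import Relation.Binary.PropositionalEquality
open import Relation.Nullary using (¬_; Dec; yes; no)
open import Relation.Nullary.Decidable using (_×-dec_; ¬?)
open import Relation.Unary using (Decidable)

-- Free names and substitution

-- Why the bounds fit: a claim is assumed below x, as ∀x'<x.ψ(x'). In the successor premise of Case
-- x this reads ∀x'<Sx.ψ(x'), so a bud reached afterwards may use ψ at the current x. Hypotheses of
-- inner levels have x as a parameter and speak of its old value; they are given up at this moment.
-- The descent is lexicographic to match: once a level has progressed, the inner entries are
-- arbitrary. Freeness protects a hypothesis on its way: its names are free in the current sequent,
-- so no eigenvariable clashes with them, and in the zero premise of Case x, where x disappears,
-- every hypothesis mentioning x is dropped. A dropping rank needs no induction on the variable of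
-- its level: companions of lower rank are derived earlier, from the outer hypotheses alone. The
-- obstacle in the simultaneous induction is that the other claims are known only below a, so the
-- induction formula has to stay provable beyond a.

ff≢tt : ∀ {A : Set} → false ≡ true → A
ff≢tt ()

¬true⇒false : ∀ {b} → ¬ (b ≡ true) → b ≡ false
¬true⇒false {true}  h = ⊥-elim (h refl)
¬true⇒false {false} h = refl

∨-true : ∀ a {b} → a ∨ b ≡ true → (a ≡ true) ⊎ (b ≡ true)
∨-true true  h = inj₁ refl
∨-true false h = inj₂ h

∨-false : ∀ a {b} → a ∨ b ≡ false → (a ≡ false) × (b ≡ false)
∨-false false h = refl , h

∨-trueˡ : ∀ {a} b → a ≡ true → a ∨ b ≡ true
∨-trueˡ b refl = refl

∨-trueʳ : ∀ a {b} → b ≡ true → a ∨ b ≡ true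
∨-trueʳ true  h = refl
∨-trueʳ false h = h

∧-true : ∀ a {b} → a ∧ b ≡ true → (a ≡ true) × (b ≡ true)
∧-true true h = refl , h

∧-intro : ∀ {a b} → a ≡ true → b ≡ true → a ∧ b ≡ true
∧-intro refl refl = refl

≡ᵇ-refl : ∀ x → (x ≡ᵇ x) ≡ true
≡ᵇ-refl x = Equivalence.to T-≡ (≡⇒≡ᵇ x x refl)

≡ᵇ-true : ∀ x y → (x ≡ᵇ y) ≡ true → x ≡ y
≡ᵇ-true x y h = ≡ᵇ⇒≡ x y (Equivalence.from T-≡ h)

≡ᵇ-false : ∀ x y → x ≢ y → (x ≡ᵇ y) ≡ false
≡ᵇ-false x y h = ¬true⇒false (λ e → h (≡ᵇ-true x y e))

wkT-id : (t : Term 0) → wkT t ≡ t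
wkT-id (var x)  = refl
wkT-id `0       = refl
wkT-id (`S t)   = cong `S (wkT-id t)
wkT-id (s `+ t) = cong₂ _`+_ (wkT-id s) (wkT-id t)
wkT-id (s `· t) = cong₂ _`·_ (wkT-id s) (wkT-id t)

openT-wkT : ∀ {n} u (t : Term 0) → openT {n} u (wkT t) ≡ wkT t
openT-wkT u (var x)  = refl
openT-wkT u `0       = refl
openT-wkT u (`S t)   = cong `S (openT-wkT u t)
openT-wkT u (s `+ t) = cong₂ _`+_ (openT-wkT u s) (openT-wkT u t)
openT-wkT u (s `· t) = cong₂ _`·_ (openT-wkT u s) (openT-wkT u t)

openT-wkT₀ : ∀ u (t : Term 0) → openT {0} u (wkT t) ≡ t
openT-wkT₀ u t = trans (openT-wkT u t) (wkT-id t)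

freeT-wkT : ∀ {n} z (t : Term 0) → freeT {n} z (wkT t) ≡ freeT z t
freeT-wkT z (var x)  = refl
freeT-wkT z `0       = refl
freeT-wkT z (`S t)   = freeT-wkT z t
freeT-wkT z (s `+ t) = cong₂ _∨_ (freeT-wkT z s) (freeT-wkT z t)
freeT-wkT z (s `· t) = cong₂ _∨_ (freeT-wkT z s) (freeT-wkT z t)

closeT-wkT : ∀ {n} x (t : Term 0) → freeT x t ≡ false → closeT {n} x (wkT t) ≡ wkT t
closeT-wkT x (var y)  h rewrite h = refl
closeT-wkT x `0       h = refl
closeT-wkT x (`S t)   h = cong `S (closeT-wkT x t h)
closeT-wkT x (s `+ t) h = let h₁ , h₂ = ∨-false (freeT x s) h in
  cong₂ _`+_ (closeT-wkT x s h₁) (closeT-wkT x t h₂)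
closeT-wkT x (s `· t) h = let h₁ , h₂ = ∨-false (freeT x s) h in
  cong₂ _`·_ (closeT-wkT x s h₁) (closeT-wkT x t h₂)

substT-wkT : ∀ {n} x u (t : Term 0) → substT {n} x u (wkT t) ≡ wkT (substT x u t)
substT-wkT x u (var y) with x ≡ᵇ y
... | true  = cong wkT (sym (wkT-id u))
... | false = refl
substT-wkT x u `0       = refl
substT-wkT x u (`S t)   = cong `S (substT-wkT x u t)
substT-wkT x u (s `+ t) = cong₂ _`+_ (substT-wkT x u s) (substT-wkT x u t)
substT-wkT x u (s `· t) = cong₂ _`·_ (substT-wkT x u s) (substT-wkT x u t)

openT-closeT : ∀ {n} x u (t : Term n) → openT u (closeT x t) ≡ substT x u t
openT-closeT x u (var y) with x ≡ᵇ y
... | true  = refl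
... | false = refl
openT-closeT x u (bv i)   = refl
openT-closeT x u `0       = refl
openT-closeT x u (`S t)   = cong `S (openT-closeT x u t)
openT-closeT x u (s `+ t) = cong₂ _`+_ (openT-closeT x u s) (openT-closeT x u t)
openT-closeT x u (s `· t) = cong₂ _`·_ (openT-closeT x u s) (openT-closeT x u t)

openF-closeF : ∀ {n} x u (φ : Formula n) → openF u (closeF x φ) ≡ substF x u φ
openF-closeF x u (s ≐ t)  = cong₂ _≐_ (openT-closeT x u s) (openT-closeT x u t)
openF-closeF x u `⊥       = refl
openF-closeF x u (φ `∧ ψ) = cong₂ _`∧_ (openF-closeF x u φ) (openF-closeF x u ψ)
openF-closeF x u (φ `∨ ψ) = cong₂ _`∨_ (openF-closeF x u φ) (openF-closeF x u ψ)
openF-closeF x u (φ ⊃ ψ)  = cong₂ _⊃_ (openF-closeF x u φ) (openF-closeF x u ψ)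
openF-closeF x u (`∀ φ)   = cong `∀ (openF-closeF x u φ)
openF-closeF x u (`∃ φ)   = cong `∃ (openF-closeF x u φ)

substT-self : ∀ {n} x (t : Term n) → substT x (var x) t ≡ t
substT-self x (var y) with x ≡ᵇ y in eq
... | true  = cong var (≡ᵇ-true x y eq)
... | false = refl
substT-self x (bv i)   = refl
substT-self x `0       = refl
substT-self x (`S t)   = cong `S (substT-self x t)
substT-self x (s `+ t) = cong₂ _`+_ (substT-self x s) (substT-self x t)
substT-self x (s `· t) = cong₂ _`·_ (substT-self x s) (substT-self x t)

substF-self : ∀ {n} x (φ : Formula n) → substF x (var x) φ ≡ φ
substF-self x (s ≐ t)  = cong₂ _≐_ (substT-self x s) (substT-self x t)
substF-self x `⊥       = refl
substF-self x (φ `∧ ψ) = cong₂ _`∧_ (substF-self x φ) (substF-self x ψ)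
substF-self x (φ `∨ ψ) = cong₂ _`∨_ (substF-self x φ) (substF-self x ψ)
substF-self x (φ ⊃ ψ)  = cong₂ _⊃_ (substF-self x φ) (substF-self x ψ)
substF-self x (`∀ φ)   = cong `∀ (substF-self x φ)
substF-self x (`∃ φ)   = cong `∃ (substF-self x φ)

openF-closeF-self : ∀ x (φ : Formula 0) → openF (var x) (closeF x φ) ≡ φ
openF-closeF-self x φ = trans (openF-closeF x (var x) φ) (substF-self x φ)

substT-fresh : ∀ {n} x u (t : Term n) → freeT x t ≡ false → substT x u t ≡ t
substT-fresh x u (var y)  h rewrite h = refl
substT-fresh x u (bv i)   h = refl
substT-fresh x u `0       h = refl
substT-fresh x u (`S t)   h = cong `S (substT-fresh x u t h)
substT-fresh x u (s `+ t) h = let h₁ , h₂ = ∨-false (freeT x s) h in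
  cong₂ _`+_ (substT-fresh x u s h₁) (substT-fresh x u t h₂)
substT-fresh x u (s `· t) h = let h₁ , h₂ = ∨-false (freeT x s) h in
  cong₂ _`·_ (substT-fresh x u s h₁) (substT-fresh x u t h₂)

substF-fresh : ∀ {n} x u (φ : Formula n) → freeF x φ ≡ false → substF x u φ ≡ φ
substF-fresh x u (s ≐ t)  h = let h₁ , h₂ = ∨-false (freeT x s) h in
  cong₂ _≐_ (substT-fresh x u s h₁) (substT-fresh x u t h₂)
substF-fresh x u `⊥       h = refl
substF-fresh x u (φ `∧ ψ) h = let h₁ , h₂ = ∨-false (freeF x φ) h in
  cong₂ _`∧_ (substF-fresh x u φ h₁) (substF-fresh x u ψ h₂)
substF-fresh x u (φ `∨ ψ) h = let h₁ , h₂ = ∨-false (freeF x φ) h in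
  cong₂ _`∨_ (substF-fresh x u φ h₁) (substF-fresh x u ψ h₂)
substF-fresh x u (φ ⊃ ψ)  h = let h₁ , h₂ = ∨-false (freeF x φ) h in
  cong₂ _⊃_ (substF-fresh x u φ h₁) (substF-fresh x u ψ h₂)
substF-fresh x u (`∀ φ)   h = cong `∀ (substF-fresh x u φ h)
substF-fresh x u (`∃ φ)   h = cong `∃ (substF-fresh x u φ h)

substT-openT : ∀ {n} z u (t : Term (suc n)) → freeT z t ≡ false →
               substT z u (openT (var z) t) ≡ openT u t
substT-openT z u (var y)        h rewrite h = refl
substT-openT z u (bv zero)      h rewrite ≡ᵇ-refl z = refl
substT-openT z u (bv (suc i))   h = refl
substT-openT z u `0             h = refl
substT-openT z u (`S t)         h = cong `S (substT-openT z u t h)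
substT-openT z u (s `+ t)       h = let h₁ , h₂ = ∨-false (freeT z s) h in
  cong₂ _`+_ (substT-openT z u s h₁) (substT-openT z u t h₂)
substT-openT z u (s `· t)       h = let h₁ , h₂ = ∨-false (freeT z s) h in
  cong₂ _`·_ (substT-openT z u s h₁) (substT-openT z u t h₂)

-- Transfers the rules that substitute for a name (`ind`, `=L`) to formulas with a de Bruijn hole:
-- the hole is first opened with a fresh name.
substF-openF : ∀ {n} z u (φ : Formula (suc n)) → freeF z φ ≡ false →
               substF z u (openF (var z) φ) ≡ openF u φ
substF-openF z u (s ≐ t)  h = let h₁ , h₂ = ∨-false (freeT z s) h in
  cong₂ _≐_ (substT-openT z u s h₁) (substT-openT z u t h₂)
substF-openF z u `⊥       h = refl
substF-openF z u (φ `∧ ψ) h = let h₁ , h₂ = ∨-false (freeF z φ) h in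
  cong₂ _`∧_ (substF-openF z u φ h₁) (substF-openF z u ψ h₂)
substF-openF z u (φ `∨ ψ) h = let h₁ , h₂ = ∨-false (freeF z φ) h in
  cong₂ _`∨_ (substF-openF z u φ h₁) (substF-openF z u ψ h₂)
substF-openF z u (φ ⊃ ψ)  h = let h₁ , h₂ = ∨-false (freeF z φ) h in
  cong₂ _⊃_ (substF-openF z u φ h₁) (substF-openF z u ψ h₂)
substF-openF z u (`∀ φ)   h = cong `∀ (substF-openF z u φ h)
substF-openF z u (`∃ φ)   h = cong `∃ (substF-openF z u φ h)

freeT-closeT : ∀ {n} z x (t : Term n) → freeT z (closeT x t) ≡ true →
               (freeT z t ≡ true) × (z ≢ x)
freeT-closeT z x (var y) h with x ≡ᵇ y in eq
... | false = h , λ { refl → ff≢tt (trans (sym eq) h) }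
freeT-closeT z x (`S t)   h = freeT-closeT z x t h
freeT-closeT z x (s `+ t) h with ∨-true (freeT z (closeT x s)) h
... | inj₁ p = let q , r = freeT-closeT z x s p in ∨-trueˡ _ q , r
... | inj₂ p = let q , r = freeT-closeT z x t p in ∨-trueʳ (freeT z s) q , r
freeT-closeT z x (s `· t) h with ∨-true (freeT z (closeT x s)) h
... | inj₁ p = let q , r = freeT-closeT z x s p in ∨-trueˡ _ q , r
... | inj₂ p = let q , r = freeT-closeT z x t p in ∨-trueʳ (freeT z s) q , r

freeF-closeF : ∀ {n} z x (φ : Formula n) → freeF z (closeF x φ) ≡ true →
               (freeF z φ ≡ true) × (z ≢ x)
freeF-closeF z x (s ≐ t) h with ∨-true (freeT z (closeT x s)) h
... | inj₁ p = let q , r = freeT-closeT z x s p in ∨-trueˡ _ q , r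
... | inj₂ p = let q , r = freeT-closeT z x t p in ∨-trueʳ (freeT z s) q , r
freeF-closeF z x (φ `∧ ψ) h with ∨-true (freeF z (closeF x φ)) h
... | inj₁ p = let q , r = freeF-closeF z x φ p in ∨-trueˡ _ q , r
... | inj₂ p = let q , r = freeF-closeF z x ψ p in ∨-trueʳ (freeF z φ) q , r
freeF-closeF z x (φ `∨ ψ) h with ∨-true (freeF z (closeF x φ)) h
... | inj₁ p = let q , r = freeF-closeF z x φ p in ∨-trueˡ _ q , r
... | inj₂ p = let q , r = freeF-closeF z x ψ p in ∨-trueʳ (freeF z φ) q , r
freeF-closeF z x (φ ⊃ ψ) h with ∨-true (freeF z (closeF x φ)) h
... | inj₁ p = let q , r = freeF-closeF z x φ p in ∨-trueˡ _ q , r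
... | inj₂ p = let q , r = freeF-closeF z x ψ p in ∨-trueʳ (freeF z φ) q , r
freeF-closeF z x (`∀ φ) h = freeF-closeF z x φ h
freeF-closeF z x (`∃ φ) h = freeF-closeF z x φ h

closeF-notfree : ∀ {n} x (φ : Formula n) → freeF x (closeF x φ) ≡ false
closeF-notfree x φ = ¬true⇒false (λ h → proj₂ (freeF-closeF x x φ h) refl)

closeF-fresh : ∀ {n} z x (φ : Formula n) → freeF z φ ≡ false → freeF z (closeF x φ) ≡ false
closeF-fresh z x φ h =
  ¬true⇒false (λ p → ff≢tt (trans (sym h) (proj₁ (freeF-closeF z x φ p))))

substT-closeT : ∀ {n} x u y (t : Term n) → x ≢ y → freeT y u ≡ false →
                substT x u (closeT y t) ≡ closeT y (substT x u t)
substT-closeT x u y (var z) x≢y h with y ≡ᵇ z in eq | x ≡ᵇ z in eq′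
... | true  | true  = ⊥-elim (x≢y (trans (≡ᵇ-true x z eq′) (sym (≡ᵇ-true y z eq))))
... | true  | false rewrite eq = refl
... | false | true  rewrite eq′ = sym (closeT-wkT y u h)
... | false | false rewrite eq | eq′ = refl
substT-closeT x u y (bv i)   d h = refl
substT-closeT x u y `0       d h = refl
substT-closeT x u y (`S t)   d h = cong `S (substT-closeT x u y t d h)
substT-closeT x u y (s `+ t) d h =
  cong₂ _`+_ (substT-closeT x u y s d h) (substT-closeT x u y t d h)
substT-closeT x u y (s `· t) d h =
  cong₂ _`·_ (substT-closeT x u y s d h) (substT-closeT x u y t d h)

substF-closeF : ∀ {n} x u y (φ : Formula n) → x ≢ y → freeT y u ≡ false →
                substF x u (closeF y φ) ≡ closeF y (substF x u φ)
substF-closeF x u y (s ≐ t)  d h =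
  cong₂ _≐_ (substT-closeT x u y s d h) (substT-closeT x u y t d h)
substF-closeF x u y `⊥       d h = refl
substF-closeF x u y (φ `∧ ψ) d h =
  cong₂ _`∧_ (substF-closeF x u y φ d h) (substF-closeF x u y ψ d h)
substF-closeF x u y (φ `∨ ψ) d h =
  cong₂ _`∨_ (substF-closeF x u y φ d h) (substF-closeF x u y ψ d h)
substF-closeF x u y (φ ⊃ ψ)  d h =
  cong₂ _⊃_ (substF-closeF x u y φ d h) (substF-closeF x u y ψ d h)
substF-closeF x u y (`∀ φ)   d h = cong `∀ (substF-closeF x u y φ d h)
substF-closeF x u y (`∃ φ)   d h = cong `∃ (substF-closeF x u y φ d h)

substT-substT : ∀ {n} x u v (t : Term n) →
                substT x u (substT x v t) ≡ substT x (substT x u v) t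
substT-substT x u v (var y) with x ≡ᵇ y in eq
... | true  = substT-wkT x u v
... | false rewrite eq = refl
substT-substT x u v (bv i)   = refl
substT-substT x u v `0       = refl
substT-substT x u v (`S t)   = cong `S (substT-substT x u v t)
substT-substT x u v (s `+ t) = cong₂ _`+_ (substT-substT x u v s) (substT-substT x u v t)
substT-substT x u v (s `· t) = cong₂ _`·_ (substT-substT x u v s) (substT-substT x u v t)

substF-substF : ∀ {n} x u v (φ : Formula n) →
                substF x u (substF x v φ) ≡ substF x (substT x u v) φ
substF-substF x u v (s ≐ t)  = cong₂ _≐_ (substT-substT x u v s) (substT-substT x u v t)
substF-substF x u v `⊥       = refl
substF-substF x u v (φ `∧ ψ) = cong₂ _`∧_ (substF-substF x u v φ) (substF-substF x u v ψ)
substF-substF x u v (φ `∨ ψ) = cong₂ _`∨_ (substF-substF x u v φ) (substF-substF x u v ψ)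
substF-substF x u v (φ ⊃ ψ)  = cong₂ _⊃_ (substF-substF x u v φ) (substF-substF x u v ψ)
substF-substF x u v (`∀ φ)   = cong `∀ (substF-substF x u v φ)
substF-substF x u v (`∃ φ)   = cong `∃ (substF-substF x u v φ)

freeT-substT-self : ∀ {n} x u (t : Term n) → freeT x u ≡ false → freeT x (substT x u t) ≡ false
freeT-substT-self x u (var y) h with x ≡ᵇ y in eq
... | true  = trans (freeT-wkT x u) h
... | false = eq
freeT-substT-self x u (bv i)   h = refl
freeT-substT-self x u `0       h = refl
freeT-substT-self x u (`S t)   h = freeT-substT-self x u t h
freeT-substT-self x u (s `+ t) h = cong₂ _∨_ (freeT-substT-self x u s h) (freeT-substT-self x u t h)
freeT-substT-self x u (s `· t) h = cong₂ _∨_ (freeT-substT-self x u s h) (freeT-substT-self x u t h)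

freeF-substF-self : ∀ {n} x u (φ : Formula n) → freeT x u ≡ false → freeF x (substF x u φ) ≡ false
freeF-substF-self x u (s ≐ t)  h = cong₂ _∨_ (freeT-substT-self x u s h) (freeT-substT-self x u t h)
freeF-substF-self x u `⊥       h = refl
freeF-substF-self x u (φ `∧ ψ) h = cong₂ _∨_ (freeF-substF-self x u φ h) (freeF-substF-self x u ψ h)
freeF-substF-self x u (φ `∨ ψ) h = cong₂ _∨_ (freeF-substF-self x u φ h) (freeF-substF-self x u ψ h)
freeF-substF-self x u (φ ⊃ ψ)  h = cong₂ _∨_ (freeF-substF-self x u φ h) (freeF-substF-self x u ψ h)
freeF-substF-self x u (`∀ φ)   h = freeF-substF-self x u φ h
freeF-substF-self x u (`∃ φ)   h = freeF-substF-self x u φ h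

freeSeq-substSeq-self : ∀ x u s → freeT x u ≡ false → freeSeq x (substSeq x u s) ≡ false
freeSeq-substSeq-self x u (Γ ⇒ δ) h = cong₂ _∨_ (list Γ) (freeF-substF-self x u δ h)
  where
  list : ∀ Γ → freeL x (map (substF x u) Γ) ≡ false
  list []      = refl
  list (φ ∷ Γ) = cong₂ _∨_ (freeF-substF-self x u φ h) (list Γ)

boundT : ∀ {n} → Term n → ℕ
boundT (var x)  = suc x
boundT (bv i)   = 0
boundT `0       = 0
boundT (`S t)   = boundT t
boundT (s `+ t) = boundT s ⊔ boundT t
boundT (s `· t) = boundT s ⊔ boundT t

boundF : ∀ {n} → Formula n → ℕ
boundF (s ≐ t)  = boundT s ⊔ boundT t
boundF `⊥       = 0
boundF (φ `∧ ψ) = boundF φ ⊔ boundF ψ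
boundF (φ `∨ ψ) = boundF φ ⊔ boundF ψ
boundF (φ ⊃ ψ)  = boundF φ ⊔ boundF ψ
boundF (`∀ φ)   = boundF φ
boundF (`∃ φ)   = boundF φ

boundL : List (Formula 0) → ℕ
boundL []      = 0
boundL (φ ∷ Γ) = boundF φ ⊔ boundL Γ

<⊔ˡ : ∀ {m n} o → m < n → m < n ⊔ o
<⊔ˡ {n = n} o h = ≤-trans h (m≤m⊔n n o)

<⊔ʳ : ∀ {m} n {o} → m < o → m < n ⊔ o
<⊔ʳ n {o} h = ≤-trans h (m≤n⊔m n o)

freeT-bound : ∀ {n} z (t : Term n) → freeT z t ≡ true → z < boundT t
freeT-bound z (var x) h rewrite ≡ᵇ-true z x h = ≤-refl
freeT-bound z (`S t)   h = freeT-bound z t h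
freeT-bound z (s `+ t) h with ∨-true (freeT z s) h
... | inj₁ p = <⊔ˡ _ (freeT-bound z s p)
... | inj₂ p = <⊔ʳ (boundT s) (freeT-bound z t p)
freeT-bound z (s `· t) h with ∨-true (freeT z s) h
... | inj₁ p = <⊔ˡ _ (freeT-bound z s p)
... | inj₂ p = <⊔ʳ (boundT s) (freeT-bound z t p)

freeF-bound : ∀ {n} z (φ : Formula n) → freeF z φ ≡ true → z < boundF φ
freeF-bound z (s ≐ t) h with ∨-true (freeT z s) h
... | inj₁ p = <⊔ˡ _ (freeT-bound z s p)
... | inj₂ p = <⊔ʳ (boundT s) (freeT-bound z t p)
freeF-bound z (φ `∧ ψ) h with ∨-true (freeF z φ) h
... | inj₁ p = <⊔ˡ _ (freeF-bound z φ p)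
... | inj₂ p = <⊔ʳ (boundF φ) (freeF-bound z ψ p)
freeF-bound z (φ `∨ ψ) h with ∨-true (freeF z φ) h
... | inj₁ p = <⊔ˡ _ (freeF-bound z φ p)
... | inj₂ p = <⊔ʳ (boundF φ) (freeF-bound z ψ p)
freeF-bound z (φ ⊃ ψ) h with ∨-true (freeF z φ) h
... | inj₁ p = <⊔ˡ _ (freeF-bound z φ p)
... | inj₂ p = <⊔ʳ (boundF φ) (freeF-bound z ψ p)
freeF-bound z (`∀ φ) h = freeF-bound z φ h
freeF-bound z (`∃ φ) h = freeF-bound z φ h

freeL-bound : ∀ z Γ → freeL z Γ ≡ true → z < boundL Γ
freeL-bound z (φ ∷ Γ) h with ∨-true (freeF z φ) h
... | inj₁ p = <⊔ˡ _ (freeF-bound z φ p)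
... | inj₂ p = <⊔ʳ (boundF φ) (freeL-bound z Γ p)

freshF : ∀ {n} z (φ : Formula n) → boundF φ ≤ z → freeF z φ ≡ false
freshF z φ h = ¬true⇒false (λ p → <-irrefl refl (≤-trans (freeF-bound z φ p) h))

freshL : ∀ z Γ → boundL Γ ≤ z → freeL z Γ ≡ false
freshL z Γ h = ¬true⇒false (λ p → <-irrefl refl (≤-trans (freeL-bound z Γ p) h))

-- Derived rules and arithmetic

module HA (P : Formula 0 → Set) (Δ0⊆P : ∀ {φ} → Δ0 φ → P φ) where

  infix 0 _⊢_
  _⊢_ : List (Formula 0) → Formula 0 → Set
  Γ ⊢ φ = HAProof P (Γ ⇒ φ)

  weaken : ∀ {Γ Δ δ} → Γ ⊆ Δ → Γ ⊢ δ → Δ ⊢ δ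
  weaken i p = rule (wk i) (p ∷ [])

  assume : ∀ {Γ φ} → φ ∈ Γ → Γ ⊢ φ
  assume {φ = φ} i = weaken (λ { (here refl) → i }) (rule (ax {[]} {φ}) [])

  hyp₀ : ∀ {Γ φ} → φ ∷ Γ ⊢ φ
  hyp₀ = assume (here refl)

  hyp₁ : ∀ {Γ φ ψ} → ψ ∷ φ ∷ Γ ⊢ φ
  hyp₁ = assume (there (here refl))

  hyp₂ : ∀ {Γ φ ψ χ} → χ ∷ ψ ∷ φ ∷ Γ ⊢ φ
  hyp₂ = assume (there (there (here refl)))

  wk₁ : ∀ {Γ φ δ} → Γ ⊢ δ → φ ∷ Γ ⊢ δ
  wk₁ = weaken there

  closed : ∀ {Γ δ} → [] ⊢ δ → Γ ⊢ δ
  closed = weaken (λ ())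

  cutE : ∀ {Γ φ δ} → Γ ⊢ φ → φ ∷ Γ ⊢ δ → Γ ⊢ δ
  cutE p q = rule cut (p ∷ q ∷ [])

  under : ∀ {Γ φ ψ δ} → φ ∷ Γ ⊢ δ → φ ∷ ψ ∷ Γ ⊢ δ
  under = weaken (λ { (here e) → here e ; (there i) → there (there i) })

  ⊃I : ∀ {Γ φ ψ} → φ ∷ Γ ⊢ ψ → Γ ⊢ φ ⊃ ψ
  ⊃I p = rule ⊃R (p ∷ [])

  ⊃E : ∀ {Γ φ ψ} → Γ ⊢ φ ⊃ ψ → Γ ⊢ φ → Γ ⊢ ψ
  ⊃E p q = cutE p (rule ⊃L (q ∷ hyp₀ ∷ []))

  ∧I : ∀ {Γ φ ψ} → Γ ⊢ φ → Γ ⊢ ψ → Γ ⊢ φ `∧ ψ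
  ∧I p q = rule ∧R (p ∷ q ∷ [])

  ∧E₁ : ∀ {Γ φ ψ} → Γ ⊢ φ `∧ ψ → Γ ⊢ φ
  ∧E₁ p = cutE p (rule ∧L (hyp₀ ∷ []))

  ∧E₂ : ∀ {Γ φ ψ} → Γ ⊢ φ `∧ ψ → Γ ⊢ ψ
  ∧E₂ p = cutE p (rule ∧L (hyp₁ ∷ []))

  ∨I₁ : ∀ {Γ φ ψ} → Γ ⊢ φ → Γ ⊢ φ `∨ ψ
  ∨I₁ p = rule ∨R₁ (p ∷ [])

  ∨I₂ : ∀ {Γ φ ψ} → Γ ⊢ ψ → Γ ⊢ φ `∨ ψ
  ∨I₂ p = rule ∨R₂ (p ∷ [])

  ∨E : ∀ {Γ φ ψ δ} → Γ ⊢ φ `∨ ψ → φ ∷ Γ ⊢ δ → ψ ∷ Γ ⊢ δ → Γ ⊢ δ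
  ∨E p q r = cutE p (rule ∨L (q ∷ r ∷ []))

  ⊥E : ∀ {Γ δ} → Γ ⊢ `⊥ → Γ ⊢ δ
  ⊥E p = cutE p (rule ⊥L [])

  ∀E : ∀ {Γ φ} t → Γ ⊢ `∀ φ → Γ ⊢ openF t φ
  ∀E t p = cutE p (rule (∀L t) (hyp₀ ∷ []))

  ∃I : ∀ {Γ φ} t → Γ ⊢ openF t φ → Γ ⊢ `∃ φ
  ∃I t p = rule (∃R t) (p ∷ [])

  -- The premise is asked for every name, so that the eigenvariable can be chosen here, beyond all
  -- names of the context and the formula, and later uses need no freshness argument.
  ∀I : ∀ {Γ φ} → (∀ y → Γ ⊢ openF (var y) φ) → Γ ⊢ `∀ φ
  ∀I {Γ} {φ} p = rule (∀R y (freshL y Γ (m≤m⊔n _ _)) (freshF y φ (m≤n⊔m _ _))) (p y ∷ [])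
    where y = boundL Γ ⊔ boundF φ

  ∃E : ∀ {Γ φ δ} → Γ ⊢ `∃ φ → (∀ y → openF (var y) φ ∷ Γ ⊢ δ) → Γ ⊢ δ
  ∃E {Γ} {φ} {δ} p q = cutE p (rule (∃L y
      (freshL y Γ (≤-trans (m≤m⊔n _ _) (m≤m⊔n _ _)))
      (freshF y φ (≤-trans (m≤n⊔m (boundL Γ) _) (m≤m⊔n _ _)))
      (freshF y δ (m≤n⊔m _ _))) (q y ∷ []))
    where y = (boundL Γ ⊔ boundF φ) ⊔ boundF δ

  allI : ∀ {Γ} x {φ} → freeL x Γ ≡ false → Γ ⊢ φ → Γ ⊢ all[ x ] φ
  allI {Γ} x {φ} h p = rule (∀R x h (closeF-notfree x φ))
    (subst (Γ ⊢_) (sym (openF-closeF-self x φ)) p ∷ [])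

  allE : ∀ {Γ} x {φ} t → Γ ⊢ all[ x ] φ → Γ ⊢ substF x t φ
  allE {Γ} x {φ} t p = subst (Γ ⊢_) (openF-closeF x t φ) (∀E t p)

  allE-self : ∀ {Γ} x {φ} → Γ ⊢ all[ x ] φ → Γ ⊢ φ
  allE-self {Γ} x {φ} p = subst (Γ ⊢_) (substF-self x φ) (allE x (var x) p)

  exI : ∀ {Γ} x {φ} t → Γ ⊢ substF x t φ → Γ ⊢ ex[ x ] φ
  exI {Γ} x {φ} t p = ∃I t (subst (Γ ⊢_) (sym (openF-closeF x t φ)) p)

  instantiate : ∀ x t {φ} → [] ⊢ φ → [] ⊢ substF x t φ
  instantiate x t p = allE x t (allI x refl p)

  Leibniz : ∀ {Γ} (φ : Formula 1) {s t} → Γ ⊢ s ≐ t → Γ ⊢ openF t φ → Γ ⊢ openF s φ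
  Leibniz {Γ} φ {s} {t} p q = ⊃E (cutE p (weaken (λ { (here e) → here e }) imp′)) q
    where
    z = boundF φ ⊔ boundF (openF t φ)
    -- `=L` passes from the instance at `t` to the instance at `s`. The antecedent does not contain
    -- the fresh `z` and stays fixed, so the instance at `t` is an identity.
    δ = openF t φ ⊃ openF (var z) φ
    δ[_] : ∀ u → substF z u δ ≡ (openF t φ ⊃ openF u φ)
    δ[ u ] = cong₂ _⊃_ (substF-fresh z u (openF t φ) (freshF z (openF t φ) (m≤n⊔m (boundF φ) _)))
                       (substF-openF z u φ (freshF z φ (m≤m⊔n _ _)))
    imp′ : (s ≐ t) ∷ [] ⊢ (openF t φ ⊃ openF s φ)
    imp′ = subst ((s ≐ t) ∷ [] ⊢_) δ[ s ]
             (rule (=L {[]} {δ} z s t) (subst ([] ⊢_) (sym δ[ t ]) (⊃I hyp₀) ∷ []))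

  ≐-refl : ∀ {Γ} t → Γ ⊢ t ≐ t
  ≐-refl t = rule (=R t) []

  rewriteEq : ∀ {Γ} (φ : Formula 1) {s t α β} → openF t φ ≡ α → openF s φ ≡ β →
              Γ ⊢ s ≐ t → Γ ⊢ α → Γ ⊢ β
  rewriteEq φ refl refl = Leibniz φ

  ≐-sym : ∀ {Γ s t} → Γ ⊢ s ≐ t → Γ ⊢ t ≐ s
  ≐-sym {s = s} {t} p = rewriteEq (wkT t ≐ bv zero)
    (cong₂ _≐_ (openT-wkT₀ t t) (wkT-id t)) (cong₂ _≐_ (openT-wkT₀ s t) (wkT-id s)) p (≐-refl t)

  ≐-trans : ∀ {Γ s t u} → Γ ⊢ s ≐ t → Γ ⊢ t ≐ u → Γ ⊢ s ≐ u
  ≐-trans {s = s} {t} {u} = rewriteEq (bv zero ≐ wkT u)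
    (cong₂ _≐_ (wkT-id t) (openT-wkT₀ t u)) (cong₂ _≐_ (wkT-id s) (openT-wkT₀ s u))

  ≐-S : ∀ {Γ s t} → Γ ⊢ s ≐ t → Γ ⊢ `S s ≐ `S t
  ≐-S {s = s} {t} p = rewriteEq (`S (bv zero) ≐ `S (wkT t))
    (cong₂ (λ a b → `S a ≐ `S b) (wkT-id t) (openT-wkT₀ t t))
    (cong₂ (λ a b → `S a ≐ `S b) (wkT-id s) (openT-wkT₀ s t)) p (≐-refl _)

  ≐-+ˡ : ∀ {Γ s t} u → Γ ⊢ s ≐ t → Γ ⊢ s `+ u ≐ t `+ u
  ≐-+ˡ {s = s} {t} u p = rewriteEq (bv zero `+ wkT u ≐ wkT (t `+ u))
    (cong₂ _≐_ (cong₂ _`+_ (wkT-id t) (openT-wkT₀ t u)) (openT-wkT₀ t (t `+ u)))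
    (cong₂ _≐_ (cong₂ _`+_ (wkT-id s) (openT-wkT₀ s u)) (openT-wkT₀ s (t `+ u))) p (≐-refl _)

  ≐-+ʳ : ∀ {Γ s t} u → Γ ⊢ s ≐ t → Γ ⊢ u `+ s ≐ u `+ t
  ≐-+ʳ {s = s} {t} u p = rewriteEq (wkT u `+ bv zero ≐ wkT (u `+ t))
    (cong₂ _≐_ (cong₂ _`+_ (openT-wkT₀ t u) (wkT-id t)) (openT-wkT₀ t (u `+ t)))
    (cong₂ _≐_ (cong₂ _`+_ (openT-wkT₀ s u) (wkT-id s)) (openT-wkT₀ s (u `+ t))) p (≐-refl _)

  ≐-·ʳ : ∀ {Γ s t} u → Γ ⊢ s ≐ t → Γ ⊢ u `· s ≐ u `· t
  ≐-·ʳ {s = s} {t} u p = rewriteEq (wkT u `· bv zero ≐ wkT (u `· t))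
    (cong₂ _≐_ (cong₂ _`·_ (openT-wkT₀ t u) (wkT-id t)) (openT-wkT₀ t (u `· t)))
    (cong₂ _≐_ (cong₂ _`·_ (openT-wkT₀ s u) (wkT-id s)) (openT-wkT₀ s (u `· t))) p (≐-refl _)

  induction : ∀ {Γ} x φ t → P φ → freeL x Γ ≡ false →
              Γ ⊢ substF x `0 φ → φ ∷ Γ ⊢ substF x (`S (var x)) φ → Γ ⊢ substF x t φ
  induction x φ t Pφ h p q = cutE (allI x h (⊃I q)) (cutE (wk₁ p)
    (weaken (λ { (here e) → here e ; (there (here e)) → there (here e) }) (ind x φ t Pφ)))

  inductionΔ0 : ∀ {Γ} (φ : Formula 1) t → (∀ x → Δ0 (openF (var x) φ)) →
                Γ ⊢ openF `0 φ → (∀ y → openF (var y) φ ∷ Γ ⊢ openF (`S (var y)) φ) →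
                Γ ⊢ openF t φ
  inductionΔ0 {Γ} φ t d p q = subst (Γ ⊢_) (substF-openF x t φ x∉φ)
      (induction x (openF (var x) φ) t (Δ0⊆P (d x)) (freshL x Γ (m≤m⊔n _ _))
        (subst (Γ ⊢_) (sym (substF-openF x `0 φ x∉φ)) p)
        (subst (openF (var x) φ ∷ Γ ⊢_) (sym (substF-openF x (`S (var x)) φ x∉φ)) (q x)))
    where
    x = boundL Γ ⊔ boundF φ
    x∉φ = freshF x φ (m≤n⊔m _ _)

  -- `f` and `g` present the two sides as functions of the term, which keeps `openT` and `wkT` out
  -- of the base case and the step.
  induction≐ : ∀ {Γ} (l r : Term 1) t (f g : Term 0 → Term 0) →
               (∀ u → openT u l ≡ f u) → (∀ u → openT u r ≡ g u) →
               Γ ⊢ f `0 ≐ g `0 →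
               (∀ y → (f (var y) ≐ g (var y)) ∷ Γ ⊢ f (`S (var y)) ≐ g (`S (var y))) →
               Γ ⊢ f t ≐ g t
  induction≐ {Γ} l r t f g ef eg p q = subst (Γ ⊢_) (e t)
      (inductionΔ0 (l ≐ r) t (λ x → eq _ _) (subst (Γ ⊢_) (sym (e `0)) p)
        (λ y → subst₂ (λ α β → α ∷ Γ ⊢ β) (sym (e (var y))) (sym (e (`S (var y)))) (q y)))
    where
    e : ∀ u → openF u (l ≐ r) ≡ (f u ≐ g u)
    e u = cong₂ _≐_ (ef u) (eg u)

  s+0 : ∀ {Γ} s → Γ ⊢ s `+ `0 ≐ s
  s+0 s = closed (rule (plus0 s) [])

  s+S : ∀ {Γ} s t → Γ ⊢ s `+ `S t ≐ `S (s `+ t)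
  s+S s t = closed (rule (plusS s t) [])

  0+ : ∀ {Γ} t → Γ ⊢ `0 `+ t ≐ t
  0+ t = induction≐ (`0 `+ bv zero) (bv zero) t (`0 `+_) (λ u → u)
    (λ u → cong (`0 `+_) (wkT-id u)) wkT-id
    (s+0 `0) (λ y → ≐-trans (s+S _ _) (≐-S hyp₀))

  S+ : ∀ {Γ} s t → Γ ⊢ `S s `+ t ≐ `S (s `+ t)
  S+ s t = induction≐ (`S (wkT s) `+ bv zero) (`S (wkT s `+ bv zero)) t
    (`S s `+_) (λ u → `S (s `+ u))
    (λ u → cong₂ (λ a b → `S a `+ b) (openT-wkT₀ u s) (wkT-id u))
    (λ u → cong₂ (λ a b → `S (a `+ b)) (openT-wkT₀ u s) (wkT-id u))
    (≐-trans (s+0 _) (≐-S (≐-sym (s+0 _))))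
    (λ y → ≐-trans (s+S _ _) (≐-S (≐-trans hyp₀ (≐-sym (s+S _ _)))))

  +-assoc : ∀ {Γ} s t u → Γ ⊢ (s `+ t) `+ u ≐ s `+ (t `+ u)
  +-assoc s t u = induction≐ ((wkT s `+ wkT t) `+ bv zero) (wkT s `+ (wkT t `+ bv zero)) u
    ((s `+ t) `+_) (λ v → s `+ (t `+ v))
    (λ v → cong₂ _`+_ (cong₂ _`+_ (openT-wkT₀ v s) (openT-wkT₀ v t)) (wkT-id v))
    (λ v → cong₂ _`+_ (openT-wkT₀ v s) (cong₂ _`+_ (openT-wkT₀ v t) (wkT-id v)))
    (≐-trans (s+0 _) (≐-+ʳ _ (≐-sym (s+0 _))))
    (λ y → ≐-trans (s+S _ _) (≐-trans (≐-S hyp₀)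
             (≐-trans (≐-sym (s+S _ _)) (≐-+ʳ _ (≐-sym (s+S _ _))))))

  S≢0 : ∀ {Γ t δ} → Γ ⊢ `0 ≐ `S t → Γ ⊢ δ
  S≢0 p = ⊥E (⊃E (closed (rule (zeroS _) [])) p)

  S-inj : ∀ {Γ s t} → Γ ⊢ `S s ≐ `S t → Γ ⊢ s ≐ t
  S-inj p = cutE p (weaken (λ { (here e) → here e }) (rule (injS _ _) []))

  <-open : ∀ u s t → openF u (wkT t ≐ wkT s `+ `S (bv zero)) ≡ (t ≐ s `+ `S u)
  <-open u s t = cong₂ _≐_ (openT-wkT₀ u t)
                   (cong₂ (λ a b → a `+ `S b) (openT-wkT₀ u s) (wkT-id u))

  <I : ∀ {Γ s t} u → Γ ⊢ t ≐ s `+ `S u → Γ ⊢ s `< t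
  <I {Γ} {s} {t} u p = ∃I u (subst (Γ ⊢_) (sym (<-open u s t)) p)

  <E : ∀ {Γ s t δ} → Γ ⊢ s `< t → (∀ y → (t ≐ s `+ `S (var y)) ∷ Γ ⊢ δ) → Γ ⊢ δ
  <E {Γ} {s} {t} {δ} p q = ∃E p
    (λ y → subst (λ χ → χ ∷ Γ ⊢ δ) (sym (<-open (var y) s t)) (q y))

  <-resp-≐ : ∀ {Γ s t u} → Γ ⊢ s `< t → Γ ⊢ t ≐ u → Γ ⊢ s `< u
  <-resp-≐ p q = <E p (λ y → <I _ (≐-trans (≐-sym (wk₁ q)) hyp₀))

  <-resp-≐ˡ : ∀ {Γ s t u} → Γ ⊢ s ≐ u → Γ ⊢ s `< t → Γ ⊢ u `< t
  <-resp-≐ˡ q p = <E p (λ y → <I _ (≐-trans hyp₀ (≐-+ˡ _ (wk₁ q))))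

  0<S : ∀ {Γ} t → Γ ⊢ `0 `< `S t
  0<S t = <I t (≐-sym (0+ _))

  -- The source of all case distinctions on numbers, obtained by induction. It says 0 < t instead of
  -- ∃y. t = Sy because only the former is a `Δ0` formula.
  zero∨pos : ∀ {Γ} t → Γ ⊢ (t ≐ `0) `∨ (`0 `< t)
  zero∨pos {Γ} t = subst (Γ ⊢_) e (inductionΔ0 φ t (λ x → or (eq _ _) (lt _ _))
      (∨I₁ (≐-refl _)) (λ y → ∨I₂ (0<S (var y))))
    where
    φ : Formula 1
    φ = (bv zero ≐ `0) `∨ `∃ (bv zero ≐ `0 `+ `S (bv (suc zero)))
    e : openF t φ ≡ ((t ≐ `0) `∨ (`0 `< t))
    e = cong (λ a → (a ≐ `0) `∨ `∃ (wkT t ≐ `0 `+ `S (bv zero))) (wkT-id t)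

  caseNat : ∀ {Γ δ} t → (t ≐ `0) ∷ Γ ⊢ δ → (∀ y → (t ≐ `S (var y)) ∷ Γ ⊢ δ) → Γ ⊢ δ
  caseNat t p q = ∨E (zero∨pos t) p
    (<E hyp₀ (λ y → cutE (≐-trans hyp₀ (0+ _)) (under (under (q y)))))

  ≮0 : ∀ {Γ s δ} → Γ ⊢ s `< `0 → Γ ⊢ δ
  ≮0 p = <E p (λ y → S≢0 (≐-trans hyp₀ (s+S _ _)))

  <S : ∀ {Γ s t} → Γ ⊢ s `< `S t → Γ ⊢ (s `< t) `∨ (s ≐ t)
  <S {Γ} {s} {t} p = <E p (λ y → cutE (S-inj (≐-trans hyp₀ (s+S _ _)))
    (caseNat (var y)
      (∨I₂ (≐-sym (≐-trans hyp₁ (≐-trans (≐-+ʳ _ hyp₀) (s+0 _)))))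
      (λ z → ∨I₁ (<I (var z) (≐-trans hyp₁ (≐-+ʳ _ hyp₀))))))

  s<Ss : ∀ {Γ} s → Γ ⊢ s `< `S s
  s<Ss s = <I `0 (≐-sym (≐-trans (s+S _ _) (≐-S (s+0 _))))

  <-trans : ∀ {Γ s t u} → Γ ⊢ s `< t → Γ ⊢ t `< u → Γ ⊢ s `< u
  <-trans p q = <E p (λ y → <E (wk₁ q) (λ z → <I (`S (var y) `+ var z)
    (≐-trans hyp₀ (≐-trans (≐-+ˡ _ hyp₁)
      (≐-trans (+-assoc _ _ _) (≐-+ʳ _ (s+S _ _)))))))

  <-step : ∀ {Γ s t} → Γ ⊢ s `< t → Γ ⊢ s `< `S t
  <-step p = <-trans p (s<Ss _)

  <-≤-trans : ∀ {Γ s t u} → Γ ⊢ s `< t → Γ ⊢ t `< `S u → Γ ⊢ s `< u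
  <-≤-trans p q = ∨E (<S q) (<-trans (wk₁ p) hyp₀) (<-resp-≐ (wk₁ p) hyp₀)

  <-+ : ∀ {Γ s t} u → Γ ⊢ s `< t → Γ ⊢ s `< (t `+ u)
  <-+ u p = <E p (λ y → <I (var y `+ u)
    (≐-trans (≐-+ˡ _ hyp₀) (≐-trans (+-assoc _ _ _) (≐-+ʳ _ (S+ _ _)))))

  <∨≥ : ∀ {Γ} s t → Γ ⊢ (s `< t) `∨ (t `< `S s)
  <∨≥ {Γ} s t = subst (Γ ⊢_) (e s)
      (inductionΔ0 φ s (λ x → subst Δ0 (sym (e (var x))) (or (lt (var x) t) (lt t (`S (var x)))))
        (subst (Γ ⊢_) (sym (e `0)) base₀)
        (λ y → subst₂ (λ α β → α ∷ Γ ⊢ β) (sym (e (var y))) (sym (e (`S (var y)))) (step y)))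
    where
    φ : Formula 1
    φ = (`∃ (wkT t ≐ bv zero `+ `S (bv (suc zero)))) `∨ (`∃ (`S (bv zero) ≐ wkT t `+ `S (bv (suc zero))))
    e : ∀ u → openF u φ ≡ ((u `< t) `∨ (t `< `S u))
    e u = cong₂ (λ a b → (`∃ (a ≐ wkT u `+ `S (bv zero))) `∨ (`∃ (`S (wkT u) ≐ b `+ `S (bv zero))))
            (openT-wkT u t) (openT-wkT u t)
    base₀ : Γ ⊢ (`0 `< t) `∨ (t `< `S `0)
    base₀ = ∨E (zero∨pos t) (∨I₂ (<-resp-≐ˡ (≐-sym hyp₀) (s<Ss _))) (∨I₁ hyp₀)
    step : ∀ y → ((var y `< t) `∨ (t `< `S (var y))) ∷ Γ ⊢ (`S (var y) `< t) `∨ (t `< `S (`S (var y)))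
    step y = ∨E hyp₀
      (<E hyp₀ (λ z → caseNat (var z)
        (∨I₂ (<-resp-≐ˡ (≐-sym (≐-trans hyp₁ (≐-trans (s+S _ _) (≐-S (≐-trans (≐-+ʳ _ hyp₀) (s+0 _))))))
                (s<Ss _)))
        (λ w → ∨I₁ (<I (var w) (≐-trans hyp₁ (≐-trans (s+S _ _)
                  (≐-trans (≐-S (≐-+ʳ _ hyp₀)) (≐-sym (S+ _ _)))))))))
      (∨I₂ (<-step hyp₀))

-- Contexts as implications, bounded quantifiers and their minimum

freeL-++ : ∀ z Γ {Δ} → freeL z (Γ ++ Δ) ≡ freeL z Γ ∨ freeL z Δ
freeL-++ z []      = refl
freeL-++ z (φ ∷ Γ) with freeF z φ
... | true  = refl
... | false = freeL-++ z Γ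

freeL-++-false : ∀ z Γ {Δ} → freeL z Γ ≡ false → freeL z Δ ≡ false → freeL z (Γ ++ Δ) ≡ false
freeL-++-false z Γ h h′ = trans (freeL-++ z Γ) (trans (cong (_∨ _) h) h′)

freeL-∈ : ∀ z {Γ φ} → φ ∈ Γ → freeF z φ ≡ true → freeL z Γ ≡ true
freeL-∈ z (here refl) h = ∨-trueˡ _ h
freeL-∈ z {ψ ∷ Γ} (there i) h = ∨-trueʳ (freeF z ψ) (freeL-∈ z i h)

freeL-all : ∀ z {Γ} → (∀ {φ} → φ ∈ Γ → freeF z φ ≡ false) → freeL z Γ ≡ false
freeL-all z {[]}    h = refl
freeL-all z {φ ∷ Γ} h = trans (cong (_∨ freeL z Γ) (h (here refl))) (freeL-all z (λ i → h (there i)))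

free-< : ∀ z s t → freeF z (s `< t) ≡ freeT z t ∨ (freeT z s ∨ false)
free-< z s t = cong₂ (λ a b → a ∨ (b ∨ false)) (freeT-wkT z t) (freeT-wkT z s)

infixr 5 _⊃*_
-- The head of the list becomes the innermost antecedent, so that `⊃*I` can discharge the head of
-- the context first.
_⊃*_ : List (Formula 0) → Formula 0 → Formula 0
[]      ⊃* δ = δ
(φ ∷ Γ) ⊃* δ = Γ ⊃* (φ ⊃ δ)

substF-⊃* : ∀ x u Γ δ → substF x u (Γ ⊃* δ) ≡ (map (substF x u) Γ ⊃* substF x u δ)
substF-⊃* x u []      δ = refl
substF-⊃* x u (φ ∷ Γ) δ = substF-⊃* x u Γ (φ ⊃ δ)

-- ∀ x < t. ψ with a bound that may itself contain x (the bound is not captured).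
below : Formula 0 → ℕ → Term 0 → Formula 0
below ψ x t = `∀ ((`∃ (wkT t ≐ bv zero `+ `S (bv (suc zero)))) ⊃ closeF x ψ)

ball≡below : ∀ x t ψ → freeT x t ≡ false → ball x t ψ ≡ below ψ x t
ball≡below x t ψ h rewrite closeT-wkT {1} x t h | ≡ᵇ-refl x = refl

substF-below : ∀ z u ψ x t → freeF z (closeF x ψ) ≡ false →
               substF z u (below ψ x t) ≡ below ψ x (substT z u t)
substF-below z u ψ x t h = cong₂ (λ a φ → `∀ ((`∃ (a ≐ bv zero `+ `S (bv (suc zero)))) ⊃ φ))
  (substT-wkT z u t) (substF-fresh z u (closeF x ψ) h)

free-below : ∀ z ψ x t → freeF z (below ψ x t) ≡ true →
             (freeT z t ≡ true) ⊎ ((freeF z ψ ≡ true) × (z ≢ x))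
free-below z ψ x t h with ∨-true ((freeT z (wkT {2} t)) ∨ false) h
... | inj₂ p = inj₂ (freeF-closeF z x ψ p)
... | inj₁ p with ∨-true (freeT z (wkT {2} t)) p
...   | inj₁ e = inj₁ (trans (sym (freeT-wkT z t)) e)

substT-var≢ : ∀ {n} z u y → z ≢ y → substT {n} z u (var y) ≡ var y
substT-var≢ z u y d rewrite ≡ᵇ-false z y d = refl

substF-<var : ∀ z u y t → z ≢ y → substF z u (var y `< t) ≡ (var y `< substT z u t)
substF-<var z u y t d = cong₂ (λ a b → `∃ (a ≐ b `+ `S (bv zero))) (substT-wkT z u t) (substT-var≢ z u y d)

substF-bex : ∀ z u y t φ → z ≢ y → freeT y u ≡ false →
             substF z u (bex y t φ) ≡ bex y (substT z u t) (substF z u φ)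
substF-bex z u y t φ d h = cong `∃ (trans (substF-closeF z u y ((var y `< t) `∧ φ) d h)
  (cong (λ χ → closeF y (χ `∧ substF z u φ)) (substF-<var z u y t d)))

substF-ball : ∀ z u y t φ → z ≢ y → freeT y u ≡ false →
              substF z u (ball y t φ) ≡ ball y (substT z u t) (substF z u φ)
substF-ball z u y t φ d h = cong `∀ (trans (substF-closeF z u y ((var y `< t) ⊃ φ) d h)
  (cong (λ χ → closeF y (χ ⊃ substF z u φ)) (substF-<var z u y t d)))

`1 `2 : Term 0
`1 = `S `0
`2 = `S `1

module Deriv (P : Formula 0 → Set) (Δ0⊆P : ∀ {φ} → Δ0 φ → P φ) where

  open HA P Δ0⊆P public

  ⊃*I : ∀ Γ {Δ δ} → Γ ++ Δ ⊢ δ → Δ ⊢ (Γ ⊃* δ)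
  ⊃*I []      p = p
  ⊃*I (φ ∷ Γ) p = ⊃*I Γ (⊃I p)

  ⊃*E : ∀ Γ {Δ δ} → Δ ⊢ (Γ ⊃* δ) → (∀ {φ} → φ ∈ Γ → Δ ⊢ φ) → Δ ⊢ δ
  ⊃*E []      p q = p
  ⊃*E (φ ∷ Γ) p q = ⊃E (⊃*E Γ p (λ i → q (there i))) (q (here refl))

  cutAll : ∀ Γ {Δ δ} → (∀ {φ} → φ ∈ Γ → Δ ⊢ φ) → Γ ++ Δ ⊢ δ → Δ ⊢ δ
  cutAll Γ p q = ⊃*E Γ (⊃*I Γ q) p

  substE : ∀ {Γ} x χ {s t} → Γ ⊢ s ≐ t → Γ ⊢ substF x t χ → Γ ⊢ substF x s χ
  substE x χ {s} {t} = rewriteEq (closeF x χ) (openF-closeF x t χ) (openF-closeF x s χ)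

  -- The sequent is packed into one formula χ, and χ(0) or χ(Sy) is carried over to χ(x) along x = 0
  -- or x = Sy. Once packed, the successor premise has an empty context, so its x may be renamed to
  -- y.
  caseRule : ∀ x Γ δ → map (substF x `0) Γ ⊢ substF x `0 δ →
             map (substF x (`S (var x))) Γ ⊢ substF x (`S (var x)) δ → Γ ⊢ δ
  caseRule x Γ δ p q = ⊃*E Γ (closed
      (caseNat (var x)
        (self (substE x χ hyp₀ (closed (subst ([] ⊢_) (sym (substF-⊃* x `0 Γ δ)) (deduct p)))))
        (λ y → self (substE x χ hyp₀ (closed (subst ([] ⊢_) (at y) (instantiate x (var y) (deduct q))))))))
      assume
    where
    χ = Γ ⊃* δ
    deduct : ∀ {Γ δ} → Γ ⊢ δ → [] ⊢ (Γ ⊃* δ)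
    deduct {Γ} r = ⊃*I Γ (weaken ∈-++⁺ˡ r)
    self : ∀ {Δ} → Δ ⊢ substF x (var x) χ → Δ ⊢ χ
    self {Δ} = subst (Δ ⊢_) (substF-self x χ)
    at : ∀ y → substF x (var y) (map (substF x (`S (var x))) Γ ⊃* substF x (`S (var x)) δ)
             ≡ substF x (`S (var y)) χ
    at y = trans (cong (substF x (var y)) (sym (substF-⊃* x (`S (var x)) Γ δ)))
      (trans (substF-substF x (var y) (`S (var x)) χ)
        (cong (λ t → substF x (`S t) χ) (h y)))
      where
      h : ∀ y → substT x (var y) (var x) ≡ var y
      h y rewrite ≡ᵇ-refl x = refl

  -- The eigenvariable of a rule is not free in its conclusion, hence not in a context `Δ` all of
  -- whose names are free in that conclusion.
  ruleInContext : ∀ {ps s} → Rule ps s → ∀ Δ →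
                  (∀ z → freeL z Δ ≡ true → freeSeq z s ≡ true) →
                  All (λ p → ctx p ++ Δ ⊢ goal p) ps → ctx s ++ Δ ⊢ goal s
  ruleInContext ax Δ f [] = rule ax []
  ruleInContext (wk i) Δ f (p ∷ []) = weaken (++⁺ i ⊆-refl) p
  ruleInContext cut Δ f (p ∷ q ∷ []) = rule cut (p ∷ q ∷ [])
  ruleInContext ⊥L Δ f [] = rule ⊥L []
  ruleInContext ∧L Δ f (p ∷ []) = rule ∧L (p ∷ [])
  ruleInContext ∧R Δ f (p ∷ q ∷ []) = rule ∧R (p ∷ q ∷ [])
  ruleInContext ∨L Δ f (p ∷ q ∷ []) = rule ∨L (p ∷ q ∷ [])
  ruleInContext ∨R₁ Δ f (p ∷ []) = rule ∨R₁ (p ∷ [])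
  ruleInContext ∨R₂ Δ f (p ∷ []) = rule ∨R₂ (p ∷ [])
  ruleInContext ⊃L Δ f (p ∷ q ∷ []) = rule ⊃L (p ∷ q ∷ [])
  ruleInContext ⊃R Δ f (p ∷ []) = rule ⊃R (p ∷ [])
  ruleInContext (∀L t) Δ f (p ∷ []) = rule (∀L t) (p ∷ [])
  ruleInContext (∀R {Γ} {φ} y hΓ hφ) Δ f (p ∷ []) =
    rule (∀R y (freeL-++-false y Γ hΓ (¬true⇒false λ e →
      ff≢tt (trans (sym (trans (cong (_∨ freeF y φ) hΓ) hφ)) (f y e)))) hφ) (p ∷ [])
  ruleInContext (∃L {Γ} {φ} {δ} y hΓ hφ hδ) Δ f (p ∷ []) =
    rule (∃L y (freeL-++-false y Γ hΓ (¬true⇒false λ e →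
      ff≢tt (trans (sym (trans (cong (λ b → (b ∨ freeL y Γ) ∨ freeF y δ) hφ)
        (trans (cong (_∨ freeF y δ) hΓ) hδ))) (f y e)))) hφ hδ) (p ∷ [])
  ruleInContext (∃R t) Δ f (p ∷ []) = rule (∃R t) (p ∷ [])
  ruleInContext (=R t) Δ f [] = rule (=R t) []
  -- `Δ` may contain `x` and must not be substituted into, so the equation is applied to `Γ ⊃* δ`
  -- alone.
  ruleInContext (=L {Γ} {δ} x s t) Δ f (p ∷ []) =
    ⊃*E (map (substF x s) Γ) (subst (_ ⊢_) (substF-⊃* x s Γ δ)
      (substE x (Γ ⊃* δ) hyp₀ (weaken (λ i → there (∈-++⁺ʳ (map (substF x s) Γ) i))
        (subst (Δ ⊢_) (sym (substF-⊃* x t Γ δ)) (⊃*I (map (substF x t) Γ) p)))))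
      (λ i → assume (there (∈-++⁺ˡ i)))
  ruleInContext (zeroS t) Δ f [] = closed (rule (zeroS t) [])
  ruleInContext (injS s t) Δ f [] = S-inj hyp₀
  ruleInContext (plus0 s) Δ f [] = closed (rule (plus0 s) [])
  ruleInContext (plusS s t) Δ f [] = closed (rule (plusS s t) [])
  ruleInContext (times0 s) Δ f [] = closed (rule (times0 s) [])
  ruleInContext (timesS s t) Δ f [] = closed (rule (timesS s t) [])

  below-open : ∀ u ψ x t → openF u ((`∃ (wkT t ≐ bv zero `+ `S (bv (suc zero)))) ⊃ closeF x ψ)
                         ≡ ((u `< t) ⊃ substF x u ψ)
  below-open u ψ x t = cong₂ (λ a φ → (`∃ (a ≐ wkT u `+ `S (bv zero))) ⊃ φ)
    (openT-wkT u t) (openF-closeF x u ψ)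

  belowE : ∀ {Γ} ψ x t u → Γ ⊢ below ψ x t → Γ ⊢ u `< t → Γ ⊢ substF x u ψ
  belowE {Γ} ψ x t u p q = ⊃E (subst (Γ ⊢_) (below-open u ψ x t) (∀E u p)) q

  belowI : ∀ {Γ} ψ x t → (∀ y → (var y `< t) ∷ Γ ⊢ substF x (var y) ψ) → Γ ⊢ below ψ x t
  belowI {Γ} ψ x t p = ∀I (λ y → subst (Γ ⊢_) (sym (below-open (var y) ψ x t)) (⊃I (p y)))

  below-mono : ∀ {Γ} ψ x t t′ → (∀ y → (var y `< t′) ∷ Γ ⊢ var y `< t) →
               Γ ⊢ below ψ x t → Γ ⊢ below ψ x t′
  below-mono ψ x t t′ h p = belowI ψ x t′ (λ y → belowE ψ x t (var y) (wk₁ p) (h y))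

  bexI : ∀ {Γ} y t φ s → freeT y t ≡ false → Γ ⊢ s `< t → Γ ⊢ substF y s φ → Γ ⊢ bex y t φ
  bexI {Γ} y t φ s h p q = exI y {(var y `< t) `∧ φ} s (∧I {φ = substF y s (var y `< t)} (subst (Γ ⊢_) (sym e) p) q)
    where
    e : substF y s (var y `< t) ≡ (s `< t)
    e rewrite ≡ᵇ-refl y = cong (λ a → `∃ (a ≐ wkT s `+ `S (bv zero)))
          (trans (substT-wkT y s t) (cong wkT (substT-fresh y s t h)))

  bexL : ∀ {Γ} y t φ {δ} → freeL y Γ ≡ false → freeF y δ ≡ false →
         φ ∷ (var y `< t) ∷ Γ ⊢ δ → bex y t φ ∷ Γ ⊢ δ
  bexL {Γ} y t φ {δ} h h′ p = rule (∃L y h (closeF-notfree y ((var y `< t) `∧ φ)) h′)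
    (subst (λ χ → χ ∷ Γ ⊢ δ) (sym (openF-closeF-self y ((var y `< t) `∧ φ)))
      (rule ∧L (weaken (λ { (here e) → there (here e) ; (there (here e)) → here e
                          ; (there (there i)) → there (there i) }) p ∷ [])) ∷ [])

  -- (∀x<u. ψ) ∨ (∀x<a. ψ), that is ∀x<min(u,a). ψ, as a formula without disjunction: the guard
  -- ∃r<p+q excludes p = q = 0, and for the other p, q < 2 the bound a·q+u·p is at least u or a.
  module MinBound (ψ : Formula 0) (x N : ℕ) (x<N : x < N) (ψ≤N : boundF ψ ≤ N) where

    a n p q r : ℕ
    a = N
    n = 1 + N
    p = 2 + N
    q = 3 + N
    r = 4 + N

    ≢+ : ∀ k M → suc k + M ≢ M
    ≢+ k M = >⇒≢ (s≤s (m≤n+m M k))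

    ψ-fresh : ∀ k → freeF (k + N) ψ ≡ false
    ψ-fresh k = freshF (k + N) ψ (≤-trans ψ≤N (m≤n+m N k))

    ≢x : ∀ k → k + N ≢ x
    ≢x k = >⇒≢ (≤-trans x<N (m≤n+m N k))

    T : Term 0 → Term 0 → Term 0 → Term 0
    T u s t = (var a `· t) `+ (u `· s)

    D : Term 0 → Term 0 → Term 0 → Formula 0
    D u s t = bex r (s `+ t) (ball x (T u s t) ψ)

    B : Term 0 → Term 0 → Formula 0
    B u s = bex q `2 (D u s (var q))

    minBound : Term 0 → Formula 0
    minBound u = bex p `2 (B u (var p))

    -- These are the names that `minBound` binds; a term free of them can replace `n` without being
    -- captured by a `closeF`.
    record Avoids (u : Term 0) : Set where
      constructor avoids
      field
        x∉ : freeT x u ≡ false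
        p∉ : freeT p u ≡ false
        q∉ : freeT q u ≡ false
        r∉ : freeT r u ≡ false

    D-subst : ∀ k v u s t → suc k + N ≢ r → Avoids v →
              substF (suc k + N) v (D u s t) ≡
              D (substT (suc k + N) v u) (substT (suc k + N) v s) (substT (suc k + N) v t)
    D-subst k v u s t z≢r (avoids x∉ _ _ r∉) =
      trans (substF-bex z v r (s `+ t) (ball x (T u s t) ψ) z≢r r∉)
        (cong (bex r (substT z v (s `+ t))) (trans (substF-ball z v x (T u s t) ψ (≢x (suc k)) x∉)
          (cong₂ (ball x) (cong (λ b → (b `· substT z v t) `+ (substT z v u `· substT z v s))
                            (substT-var≢ z v a (≢+ k N)))
                          (substF-fresh z v ψ (ψ-fresh (suc k))))))
      where z = suc k + N

    B-subst : ∀ k v u s → suc k + N ≢ r → suc k + N ≢ q → Avoids v →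
              substF (suc k + N) v (B u s) ≡ B (substT (suc k + N) v u) (substT (suc k + N) v s)
    B-subst k v u s z≢r z≢q av@(avoids _ _ q∉ _) =
      trans (substF-bex z v q `2 (D u s (var q)) z≢q q∉)
        (cong (bex q `2) (trans (D-subst k v u s (var q) z≢r av)
          (cong (D (substT z v u) (substT z v s)) (substT-var≢ z v q z≢q))))
      where z = suc k + N

    minBound-subst : ∀ v → Avoids v → substF n v (minBound (var n)) ≡ minBound v
    minBound-subst v av@(avoids _ p∉ _ _) =
      trans (substF-bex n v p `2 (B (var n) (var p)) n≢p p∉)
        (cong (bex p `2) (trans (B-subst 0 v (var n) (var p) (λ e → ≢+ 2 n (sym e)) (λ e → ≢+ 1 n (sym e)) av)
          (cong₂ B lem (substT-var≢ n v p n≢p))))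
      where
      n≢p : n ≢ p
      n≢p e = ≢+ 0 n (sym e)
      lem : substT n v (var n) ≡ v
      lem rewrite ≡ᵇ-refl N = wkT-id v

    free-T : ∀ z u s t → z ≢ a → freeT z u ≡ false → freeT z s ≡ false → freeT z t ≡ false →
             freeT z (T u s t) ≡ false
    free-T z u s t z≢a hu hs ht rewrite ≡ᵇ-false z a z≢a | hu | hs | ht = refl

    x≢ : ∀ k → x ≢ k + N
    x≢ k e = ≢x k (sym e)

    minBound-Pi : ∀ {Q : Formula 0 → Set} → Pi Q ψ → Pi Q (minBound (var n))
    minBound-Pi π = pbex p `2 refl (pbex q `2 refl (pbex r (var p `+ var q) r∉
        (pball x (T (var n) (var p) (var q))
          (free-T x (var n) (var p) (var q) (x≢ 0) (≡ᵇ-false x n (x≢ 1)) (≡ᵇ-false x p (x≢ 2)) (≡ᵇ-false x q (x≢ 3))) π)))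
      where
      r∉ = cong₂ _∨_ (≡ᵇ-false r p (≢+ 1 p)) (≡ᵇ-false r q (≢+ 0 q))

    <2E : ∀ {Γ s δ} → Γ ⊢ s `< `2 → (s ≐ `0) ∷ Γ ⊢ δ → (s ≐ `1) ∷ Γ ⊢ δ → Γ ⊢ δ
    <2E h c₀ c₁ = ∨E (<S h) (∨E (<S hyp₀) (≮0 hyp₀) (under c₀)) c₁

    ·0 : ∀ {Γ t} s → Γ ⊢ t ≐ `0 → Γ ⊢ s `· t ≐ `0
    ·0 s h = ≐-trans (≐-·ʳ s h) (closed (rule (times0 s) []))

    ·1 : ∀ {Γ t} s → Γ ⊢ t ≐ `1 → Γ ⊢ s `· t ≐ s
    ·1 s h = ≐-trans (≐-·ʳ s h) (≐-trans (closed (rule (timesS s `0) []))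
               (≐-trans (≐-+ˡ s (closed (rule (times0 s) []))) (0+ s)))

    minBoundE : ∀ {Γ} u → Avoids u → (∀ k → freeL (suc (suc k) + N) Γ ≡ false) →
                minBound u ∷ Γ ⊢ below ψ x u `∨ below ψ x (var a)
    minBoundE {Γ} u (avoids x∉ p∉ q∉ r∉) Γ-fresh =
        bexL p `2 (B u (var p)) (Γ-fresh 0) (δ-fresh 1 p∉)
          (bexL q `2 (D u (var p) (var q))
            (trans (cong (_∨ freeL q Γ) (<2-fresh q p (≢+ 0 p))) (Γ-fresh 1)) (δ-fresh 2 q∉)
            (bexL r (var p `+ var q) (ball x t ψ)
              (trans (cong (_∨ freeL r ((var p `< `2) ∷ Γ)) (<2-fresh r q (≢+ 0 q)))
                (trans (cong (_∨ freeL r Γ) (<2-fresh r p (≢+ 1 p))) (Γ-fresh 2))) (δ-fresh 3 r∉)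
              main))
      where
      δ-fresh : ∀ k → freeT (suc k + N) u ≡ false →
                freeF (suc k + N) (below ψ x u `∨ below ψ x (var a)) ≡ false
      δ-fresh k h = ¬true⇒false λ e → go (∨-true (freeF (suc k + N) (below ψ x u)) e)
        where
        ψ∌ : ∀ {A : Set} → freeF (suc k + N) ψ ≡ true → A
        ψ∌ e = ff≢tt (trans (sym (ψ-fresh (suc k))) e)
        go : ∀ {A : Set} → (freeF (suc k + N) (below ψ x u) ≡ true) ⊎
                           (freeF (suc k + N) (below ψ x (var a)) ≡ true) → A
        go (inj₁ e) with free-below (suc k + N) ψ x u e
        ... | inj₁ e′ = ff≢tt (trans (sym h) e′)
        ... | inj₂ (e′ , _) = ψ∌ e′
        go (inj₂ e) with free-below (suc k + N) ψ x (var a) e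
        ... | inj₁ e′ = ⊥-elim (≢+ k N (≡ᵇ-true _ _ e′))
        ... | inj₂ (e′ , _) = ψ∌ e′
      <2-fresh : ∀ z y → z ≢ y → freeF z (var y `< `2) ≡ false
      <2-fresh z y d = trans (free-< z (var y) `2) (cong (_∨ false) (≡ᵇ-false z y d))
      t = T u (var p) (var q)
      main : ball x t ψ ∷ (var r `< (var p `+ var q)) ∷ (var q `< `2) ∷ (var p `< `2) ∷ Γ ⊢
             below ψ x u `∨ below ψ x (var a)
      main = subst (λ χ → χ ∷ (var r `< (var p `+ var q)) ∷ (var q `< `2) ∷ (var p `< `2) ∷ Γ ⊢
                      below ψ x u `∨ below ψ x (var a))
          (sym (ball≡below x t ψ (free-T x u (var p) (var q) (x≢ 0) x∉ (≡ᵇ-false x p (x≢ 2)) (≡ᵇ-false x q (x≢ 3)))))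
          -- If q = 1, the bound is at least a for either p. If q = 0, then p = 0 leaves no r below
          -- p + q, and p = 1 makes the bound equal to u.
          (<2E hyp₂
            (<2E (assume (there (there (there (there (here refl))))))
              (≮0 (<-resp-≐ (assume (there (there (there (here refl)))))
                (≐-trans (≐-+ˡ _ hyp₀) (≐-trans (≐-+ʳ _ hyp₁) (s+0 _)))))
              (∨I₁ (below-mono ψ x t u
                (λ y → <-resp-≐ hyp₀ (≐-sym (≐-trans (≐-+ˡ _ (·0 _ hyp₂))
                          (≐-trans (0+ _) (·1 _ hyp₁)))))
                hyp₂)))
            (∨I₂ (below-mono ψ x t (var a)
              (λ y → <-resp-≐ (<-+ (u `· var p) hyp₀) (≐-+ˡ _ (≐-sym (·1 _ hyp₁))))
              hyp₁)))

    minBoundI : ∀ {Γ} u s t → Avoids u → (∀ z → freeT z s ≡ false) → (∀ z → freeT z t ≡ false) →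
                Γ ⊢ s `< `2 → Γ ⊢ t `< `2 → Γ ⊢ `0 `< (s `+ t) → Γ ⊢ below ψ x (T u s t) →
                Γ ⊢ minBound u
    minBoundI {Γ} u s t (avoids x∉ p∉ q∉ r∉) s∌ t∌ hs ht hst h =
        bexI p `2 (B u (var p)) s refl hs (subst (Γ ⊢_) (sym eB)
          (bexI q `2 (D u s (var q)) t refl ht (subst (Γ ⊢_) (sym eD)
            (bexI r (s `+ t) (ball x (T u s t) ψ) `0 (trans (cong (_∨ freeT r t) (s∌ r)) (t∌ r)) hst (subst (Γ ⊢_) (sym eT) h)))))
      where
      self : ∀ y v → substT y v (var y) ≡ v
      self y v rewrite ≡ᵇ-refl y = wkT-id v
      eB : substF p s (B u (var p)) ≡ B u s
      eB = trans (B-subst 1 s u (var p) (λ e → ≢+ 1 p (sym e)) (λ e → ≢+ 0 p (sym e))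
                   (avoids (s∌ x) (s∌ p) (s∌ q) (s∌ r)))
             (cong₂ B (substT-fresh p s u p∉) (self p s))
      eD : substF q t (D u s (var q)) ≡ D u s t
      eD = trans (D-subst 2 t u s (var q) (λ e → ≢+ 0 q (sym e)) (avoids (t∌ x) (t∌ p) (t∌ q) (t∌ r)))
             (trans (cong₂ (λ b c → D b c (substT q t (var q))) (substT-fresh q t u q∉) (substT-fresh q t s (s∌ q)))
               (cong (D u s) (self q t)))
      eT : substF r `0 (ball x (T u s t) ψ) ≡ below ψ x (T u s t)
      eT = trans (substF-ball r `0 x (T u s t) ψ (≢x 4) refl)
             (trans (cong₂ (ball x) (substT-fresh r `0 (T u s t) (free-T r u s t (≢+ 3 N) r∉ (s∌ r) (t∌ r)))
                       (substF-fresh r `0 ψ (ψ-fresh 4)))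
               (ball≡below x (T u s t) ψ (free-T x u s t (x≢ 0) x∉ (s∌ x) (t∌ x))))

    minBoundI₁ : ∀ {Γ} u → Avoids u → Γ ⊢ below ψ x u → Γ ⊢ minBound u
    minBoundI₁ u av h = minBoundI u `1 `0 av (λ z → refl) (λ z → refl) (s<Ss _) (0<S _)
      (<-resp-≐ (0<S `0) (≐-sym (s+0 _)))
      (below-mono ψ x u _ (λ y → <-resp-≐ hyp₀
        (≐-trans (≐-+ˡ _ (·0 _ (≐-refl _))) (≐-trans (0+ _) (·1 _ (≐-refl _))))) h)

    minBoundI₂ : ∀ {Γ} u → Avoids u → Γ ⊢ below ψ x (var a) → Γ ⊢ minBound u
    minBoundI₂ u av h = minBoundI u `0 `1 av (λ z → refl) (λ z → refl) (0<S _) (s<Ss _)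
      (<-resp-≐ (0<S `0) (≐-sym (0+ _)))
      (below-mono ψ x (var a) _ (λ y → <-resp-≐ hyp₀
        (≐-trans (≐-+ʳ _ (·0 _ (≐-refl _))) (≐-trans (s+0 _) (·1 _ (≐-refl _))))) h)

-- Simultaneous course-of-values induction

belows : ℕ → List (Formula 0) → Term 0 → List (Formula 0)
belows x S t = map (λ ψ → below ψ x t) S

substF-belows : ∀ z u x S t → (∀ {ψ} → ψ ∈ S → freeF z (closeF x ψ) ≡ false) →
                map (substF z u) (belows x S t) ≡ belows x S (substT z u t)
substF-belows z u x []      t h = refl
substF-belows z u x (ψ ∷ S) t h =
  cong₂ _∷_ (substF-below z u ψ x t (h (here refl))) (substF-belows z u x S t (λ i → h (there i)))

substT-var-self : ∀ x (u : Term 0) → substT x u (var x) ≡ u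
substT-var-self x u rewrite ≡ᵇ-refl x = wkT-id u

module Induction (P : Formula 0 → Set) (Δ0⊆P : ∀ {φ} → Δ0 φ → P φ)
                 (Q : Formula 0 → Set) (Pi⊆P : ∀ {φ} → Pi Q φ → P φ) where

  open Deriv P Δ0⊆P public

  -- With `a` fixed and the hypotheses of `S` known below it, induction on n proves ∀x<min(n,a).ψ.
  -- The limit `a` is kept apart from `x` because the step instantiates `x` with n. At n = a both
  -- alternatives of the minimum are the same formula; then `a` is generalised and replaced by `x`.
  boundedInduction : ∀ Δ x S ψ → freeL x Δ ≡ false → Pi Q ψ →
    belows x S (var x) ++ below ψ x (var x) ∷ Δ ⊢ ψ → belows x S (var x) ++ Δ ⊢ below ψ x (var x)
  boundedInduction Δ x S ψ x∉Δ π prem =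
      ⊃*E (belows x S (var x)) (weaken (∈-++⁺ʳ (belows x S (var x))) general)
        (λ i → assume (∈-++⁺ˡ i))
    where
    N = (boundL Δ ⊔ boundL S) ⊔ (boundF ψ ⊔ suc x)
    open MinBound ψ x N (≤-trans (m≤n⊔m (boundF ψ) _) (m≤n⊔m (boundL Δ ⊔ boundL S) _))
                        (≤-trans (m≤m⊔n _ _) (m≤n⊔m (boundL Δ ⊔ boundL S) _))
    H : Term 0 → Formula 0
    H = below ψ x
    Γa = belows x S (var a) ++ Δ

    step : Δ ⊢ all[ x ] (belows x S (var x) ⊃* (H (var x) ⊃ ψ))
    step = allI x x∉Δ (⊃*I (belows x S (var x)) (⊃I (weaken swap prem)))
      where
      swap : belows x S (var x) ++ H (var x) ∷ Δ ⊆ H (var x) ∷ belows x S (var x) ++ Δ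
      swap i with ∈-++⁻ (belows x S (var x)) i
      ... | inj₁ j         = there (∈-++⁺ˡ j)
      ... | inj₂ (here e)  = here e
      ... | inj₂ (there j) = there (∈-++⁺ʳ (belows x S (var x)) j)

    stepAt : ∀ {Γ} u → Δ ⊆ Γ → (∀ {χ} → χ ∈ S → Γ ⊢ below χ x u) → Γ ⊢ H u → Γ ⊢ substF x u ψ
    stepAt {Γ} u i hS hψ = ⊃E (⊃*E (belows x S u) (subst (Γ ⊢_) e (allE x u (weaken i step)))
                              (λ j → let χ , k , e′ = ∈-map⁻ _ j in subst (Γ ⊢_) (sym e′) (hS k))) hψ
      where
      e : substF x u (belows x S (var x) ⊃* (H (var x) ⊃ ψ)) ≡ (belows x S u ⊃* (H u ⊃ substF x u ψ))
      e = trans (substF-⊃* x u (belows x S (var x)) _)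
            (cong₂ (λ Γ φ → Γ ⊃* (φ ⊃ substF x u ψ))
              (trans (substF-belows x u x S (var x) (λ {χ} _ → closeF-notfree x χ))
                     (cong (belows x S) (substT-var-self x u)))
              (trans (substF-below x u ψ x (var x) (closeF-notfree x ψ)) (cong H (substT-var-self x u))))

    S-fresh : ∀ k {χ} → χ ∈ S → freeF (k + N) χ ≡ false
    S-fresh k {χ} i = ¬true⇒false λ e → <-irrefl refl
      (≤-trans (freeL-bound (k + N) S (freeL-∈ (k + N) i e))
        (≤-trans (m≤n⊔m (boundL Δ) _) (≤-trans (m≤m⊔n _ _) (m≤n+m N k))))

    Δ-fresh : ∀ k → freeL (k + N) Δ ≡ false
    Δ-fresh k = freshL (k + N) Δ (≤-trans (m≤m⊔n _ _) (≤-trans (m≤m⊔n _ _) (m≤n+m N k)))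

    Γa-fresh : ∀ k → freeL (suc k + N) Γa ≡ false
    Γa-fresh k = freeL-++-false (suc k + N) (belows x S (var a)) (freeL-all (suc k + N) fr) (Δ-fresh (suc k))
      where
      fr : ∀ {φ} → φ ∈ belows x S (var a) → freeF (suc k + N) φ ≡ false
      fr i with ∈-map⁻ _ i
      ... | χ , j , refl = ¬true⇒false λ e → split (free-below (suc k + N) χ x (var a) e)
        where
        split : ∀ {A : Set} → (freeT (suc k + N) (var {0} a) ≡ true) ⊎ ((freeF (suc k + N) χ ≡ true) × (suc k + N ≢ x)) → A
        split (inj₁ e)       = ⊥-elim (≢+ k N (≡ᵇ-true _ _ e))
        split (inj₂ (e , _)) = ff≢tt (trans (sym (S-fresh (suc k) j)) e)

    avoid-n : Avoids (var n)
    avoid-n = avoids (≡ᵇ-false x n (x≢ 1)) (≡ᵇ-false p n (≢+ 0 n)) (≡ᵇ-false q n (≢+ 1 n)) (≡ᵇ-false r n (≢+ 2 n))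

    avoid-Sn : Avoids (`S (var n))
    avoid-Sn = avoids (≡ᵇ-false x n (x≢ 1)) (≡ᵇ-false p n (≢+ 0 n)) (≡ᵇ-false q n (≢+ 1 n)) (≡ᵇ-false r n (≢+ 2 n))

    avoid-a : Avoids (var a)
    avoid-a = avoids (≡ᵇ-false x a (x≢ 0)) (≡ᵇ-false p a (≢+ 1 a)) (≡ᵇ-false q a (≢+ 2 a)) (≡ᵇ-false r a (≢+ 3 a))

    minStep : minBound (var n) ∷ Γa ⊢ minBound (`S (var n))
    minStep = ∨E (minBoundE (var n) avoid-n (λ k → Γa-fresh (suc k)))
      -- If n < a, the hypotheses below a restrict to n, so ψ(n) follows and the bound grows to Sn.
      -- If a ≤ n, what is known below n already covers everything below a.
      (∨E (<∨≥ (var n) (var a))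
        (minBoundI₁ (`S (var n)) avoid-Sn (belowI ψ x (`S (var n)) (λ y → ∨E (<S hyp₀)
          (belowE ψ x (var n) (var y) (assume (there (there (there (here refl))))) hyp₀)
          (substE x ψ hyp₀ (stepAt (var n)
            (λ i → there (there (there (there (there (∈-++⁺ʳ (belows x S (var a)) i))))))
            (λ {χ} i → below-mono χ x (var a) (var n)
              (λ z → <-trans hyp₀ (assume (there (there (there (here refl))))))
              (assume (there (there (there (there (there (∈-++⁺ˡ (∈-map⁺ (λ χ → below χ x (var a)) i))))))))) 
            (assume (there (there (there (here refl))))))))))
        (minBoundI₂ (`S (var n)) avoid-Sn
          (below-mono ψ x (var n) (var a) (λ y → <-≤-trans hyp₀ hyp₁) hyp₁)))
      (minBoundI₂ (`S (var n)) avoid-Sn hyp₀)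

    atA : Γa ⊢ H (var a)
    atA = cutE (subst (Γa ⊢_) (minBound-subst (var a) avoid-a)
        (induction n (minBound (var n)) (var a) (Pi⊆P (minBound-Pi π)) (Γa-fresh 0)
          (subst (Γa ⊢_) (sym (minBound-subst `0 (avoids refl refl refl refl)))
            (minBoundI₁ `0 (avoids refl refl refl refl) (belowI ψ x `0 (λ y → ≮0 hyp₀))))
          (subst (minBound (var n) ∷ Γa ⊢_) (sym (minBound-subst (`S (var n)) avoid-Sn)) minStep)))
      (∨E (minBoundE (var a) avoid-a (λ k → Γa-fresh (suc k))) hyp₀ hyp₀)

    general : Δ ⊢ (belows x S (var x) ⊃* H (var x))
    general = subst (Δ ⊢_) e (allE a (var x) (allI a (Δ-fresh 0) (⊃*I (belows x S (var a)) atA)))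
      where
      e : substF a (var x) (belows x S (var a) ⊃* H (var a)) ≡ (belows x S (var x) ⊃* H (var x))
      e = trans (substF-⊃* a (var x) (belows x S (var a)) _)
            (cong₂ _⊃*_
              (trans (substF-belows a (var x) x S (var a) (λ {χ} i → closeF-fresh a x χ (S-fresh 0 i)))
                     (cong (belows x S) (substT-var-self a (var x))))
              (trans (substF-below a (var x) ψ x (var a) (closeF-fresh a x ψ (ψ-fresh 0)))
                     (cong H (substT-var-self a (var x)))))

  -- The hypotheses are eliminated one at a time: `boundedInduction` derives the one of the head `w`
  -- from the remaining ones, and a cut removes it from the premises of all claims. Each induction
  -- formula thus concerns a single claim.
  mutualInduction : ∀ Δ x S → freeL x Δ ≡ false → All (Pi Q) S →
    (∀ {ψ} → ψ ∈ S → belows x S (var x) ++ Δ ⊢ ψ) → ∀ {ψ} → ψ ∈ S → Δ ⊢ ψ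
  mutualInduction Δ x S x∉Δ πs prem = peel S (λ i → i) prem
    where
    peel : ∀ U → U ⊆ S → (∀ {ψ} → ψ ∈ S → belows x U (var x) ++ Δ ⊢ ψ) → ∀ {ψ} → ψ ∈ S → Δ ⊢ ψ
    peel []      U⊆S h = h
    peel (w ∷ U) U⊆S h = peel U (λ i → U⊆S (there i)) (λ i → cutE Hw (h i))
      where
      swap : below w x (var x) ∷ belows x U (var x) ++ Δ ⊆ belows x U (var x) ++ below w x (var x) ∷ Δ
      swap (here e)  = ∈-++⁺ʳ (belows x U (var x)) (here e)
      swap (there i) with ∈-++⁻ (belows x U (var x)) i
      ... | inj₁ j = ∈-++⁺ˡ j
      ... | inj₂ j = ∈-++⁺ʳ (belows x U (var x)) (there j)
      Hw : belows x U (var x) ++ Δ ⊢ below w x (var x)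
      Hw = boundedInduction Δ x U w x∉Δ (All.lookup πs (U⊆S (here refl)))
             (weaken swap (h (U⊆S (here refl))))

-- Ranking finite graphs

Entry : Set
Entry = ℕ × Maybe ℕ

-- A lexicographic descent in which passing a Case counts like a decrease. `F` and `K` are arbitrary
-- so that one relation serves both edges and whole paths.
data Descent (F K : ℕ → Bool) : List Entry → List Entry → Set where
  lower : ∀ {n n′ m m′ ρ ρ′} → n′ < n → Descent F K ((n , m) ∷ ρ) ((n′ , m′) ∷ ρ′)
  prog  : ∀ {n x ρ ρ′} → F x ≡ true → K x ≡ true →
          Descent F K ((n , just x) ∷ ρ) ((n , just x) ∷ ρ′)
  keep  : ∀ {n m ρ ρ′} → (∀ {x} → m ≡ just x → F x ≡ true) → Descent F K ρ ρ′ →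
          Descent F K ((n , m) ∷ ρ) ((n , m) ∷ ρ′)

Descent-mono : ∀ {F K F′ K′ ρ ρ′} → (∀ {x} → F x ≡ true → F′ x ≡ true) →
               (∀ {x} → K x ≡ true → K′ x ≡ true) → Descent F K ρ ρ′ → Descent F′ K′ ρ ρ′
Descent-mono i j (lower l)  = lower l
Descent-mono i j (prog f k) = prog (i f) (j k)
Descent-mono i j (keep f d) = keep (λ e → i (f e)) (Descent-mono i j d)

-- On a composed path only names free on both parts count as free, while a Case on either part
-- suffices. The outermost decisive level of the two parts decides.
Descent-trans : ∀ {F K F′ K′ F″ K″ ρ ρ′ ρ″} →
                (∀ {x} → F x ≡ true → F′ x ≡ true → F″ x ≡ true) →
                (∀ {x} → K x ≡ true → K″ x ≡ true) → (∀ {x} → K′ x ≡ true → K″ x ≡ true) →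
                Descent F K ρ ρ′ → Descent F′ K′ ρ′ ρ″ → Descent F″ K″ ρ ρ″
Descent-trans i j k (lower l)  (lower l′)   = lower (ℕₚ.<-trans l′ l)
Descent-trans i j k (lower l)  (prog _ _)   = lower l
Descent-trans i j k (lower l)  (keep _ _)   = lower l
Descent-trans i j k (prog _ _) (lower l)    = lower l
Descent-trans i j k (prog f h) (prog f′ _)  = prog (i f f′) (j h)
Descent-trans i j k (prog f h) (keep f′ _)  = prog (i f (f′ refl)) (j h)
Descent-trans i j k (keep _ _) (lower l)    = lower l
Descent-trans i j k (keep f _) (prog f′ h)  = prog (i (f refl) f′) (k h)
Descent-trans i j k (keep f d) (keep f′ d′) = keep (λ e → i (f e) (f′ e)) (Descent-trans i j k d d′)

module _ {A : Set} {P Q : A → Set} (P? : Decidable P) (Q? : Decidable Q) where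

  length-filter-mono : (∀ {x} → P x → Q x) → ∀ xs → length (filter P? xs) ≤ length (filter Q? xs)
  length-filter-mono i [] = z≤n
  length-filter-mono i (x ∷ xs) with P? x | Q? x
  ... | yes p | yes q = s≤s (length-filter-mono i xs)
  ... | yes p | no ¬q = ⊥-elim (¬q (i p))
  ... | no ¬p | yes q = m≤n⇒m≤1+n (length-filter-mono i xs)
  ... | no ¬p | no ¬q = length-filter-mono i xs

  length-filter-strict : (∀ {x} → P x → Q x) → ∀ {x xs} → x ∈ xs → ¬ P x → Q x →
                         length (filter P? xs) < length (filter Q? xs)
  length-filter-strict i {x} {y ∷ xs} (here refl) ¬p q with P? x | Q? x
  ... | yes p | _     = ⊥-elim (¬p p)
  ... | no _  | yes _ = s≤s (length-filter-mono i xs)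
  ... | no _  | no ¬q = ⊥-elim (¬q q)
  length-filter-strict i {x} {y ∷ xs} (there j) ¬p q with P? y | Q? y
  ... | yes p | yes q′ = s≤s (length-filter-strict i j ¬p q)
  ... | yes p | no ¬q  = ⊥-elim (¬q (i p))
  ... | no _  | yes _  = m≤n⇒m≤1+n (length-filter-strict i j ¬p q)
  ... | no _  | no _   = length-filter-strict i j ¬p q

module Graph {V : Set} (_≟_ : DecidableEquality V) where

  Path : List (V × V) → V → V → Set
  Path A = Star (λ u v → (u , v) ∈ A)

  -- Recursion on the edges: a path through the new edge (a , b) can be cut before its first and
  -- after its last use of that edge, which leaves two paths along old edges.
  reach? : ∀ A u v → Dec (Path A u v)
  reach? [] u v with u ≟ v
  ... | yes refl = yes ε
  ... | no u≢v   = no λ { ε → u≢v refl }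
  reach? ((a , b) ∷ A) u v with reach? A u v | reach? A u a ×-dec reach? A b v
  ... | yes p | _           = yes (gmap (λ w → w) there p)
  ... | no _  | yes (p , q) = yes (gmap (λ w → w) there p ◅◅ (here refl ◅ gmap (λ w → w) there q))
  ... | no ¬p | no ¬q       = no λ r → refute (split r)
    where
    split : ∀ {u} → Path ((a , b) ∷ A) u v → Path A u v ⊎ (Path A u a × Path A b v)
    split ε = inj₁ ε
    split (here refl ◅ p) with split p
    ... | inj₁ q       = inj₂ (ε , q)
    ... | inj₂ (_ , q) = inj₂ (ε , q)
    split (there i ◅ p) with split p
    ... | inj₁ q       = inj₁ (i ◅ q)
    ... | inj₂ (q , r) = inj₂ (i ◅ q , r)
    refute : ¬ (Path A u v ⊎ (Path A u a × Path A b v))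
    refute (inj₁ p) = ¬p p
    refute (inj₂ q) = ¬q q

  -- Counting edges with reachable source avoids a list of vertices. Along an edge without a way
  -- back the count drops, since the source of that edge itself is lost.
  rank : List (V × V) → V → ℕ
  rank A u = length (filter (reach? A u) (map proj₁ A))

  rank-≤ : ∀ A {u v} → Path A u v → rank A v ≤ rank A u
  rank-≤ A {u} {v} p = length-filter-mono (reach? A v) (reach? A u) (p ◅◅_) (map proj₁ A)

  rank-< : ∀ A {u v} → (u , v) ∈ A → ¬ Path A v u → rank A v < rank A u
  rank-< A {u} {v} e ¬p =
    length-filter-strict (reach? A v) (reach? A u) (e ◅_) (∈-map⁺ proj₁ e) ¬p ε

  On : ∀ {A c c′} → V → Path A c c′ → Set
  On {A} {c} {c′} u w = Σ (Path A c u) λ p → Σ (Path A u c′) λ q → p ◅◅ q ≡ w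

  On-◅◅ˡ : ∀ {A c d e u} {w : Path A c d} (w′ : Path A d e) → On u w → On u (w ◅◅ w′)
  On-◅◅ˡ w′ (p , q , refl) = p , q ◅◅ w′ , sym (◅◅-assoc p q w′)

  On-◅◅ʳ : ∀ {A c d e u} (w : Path A c d) {w′ : Path A d e} → On u w′ → On u (w ◅◅ w′)
  On-◅◅ʳ w (p , q , refl) = w ◅◅ p , q , ◅◅-assoc w p q

  Internal : List (V × V) → V → V × V → Set
  Internal A c (u , v) = Path A c u × Path A v c

  -- For each edge inside the component of `c`, a loop is prepended that runs from `c` to the
  -- source, across the edge, and back to `c`.
  tour : ∀ A c L → L ⊆ A →
         Σ (Path A c c) λ w → ∀ {u v} → (u , v) ∈ L → Internal A c (u , v) → On u w × On v w
  tour A c [] i = ε , λ ()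
  tour A c ((a , b) ∷ L) i with tour A c L (λ j → i (there j)) | reach? A c a ×-dec reach? A b c
  ... | w , h | no ¬int       = w , λ { (here refl) int → ⊥-elim (¬int int) ; (there j) int → h j int }
  ... | w , h | yes (p , q)   = loop ◅◅ w , λ
    { (here refl) int → On-◅◅ˡ w (p , i (here refl) ◅ q , refl)
                      , On-◅◅ˡ w (p ◅◅ (i (here refl) ◅ ε) , q , ◅◅-assoc p (i (here refl) ◅ ε) q)
    ; (there j)   int → On-◅◅ʳ loop (proj₁ (h j int)) , On-◅◅ʳ loop (proj₂ (h j int)) }
    where
    loop : Path A c c
    loop = p ◅◅ (i (here refl) ◅ q)

  module Cycle {A : List (V × V)} {c c₁ : V} (e₀ : (c , c₁) ∈ A) (w : Path A c₁ c) where

    -- The part of the lap already walked is stored along with the part ahead. Together they certify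
    -- that the current vertex lies in the component of `c`, as is needed for the Case found on the
    -- branch.
    State : Set
    State = Σ V λ d → Path A c d × Path A d c

    next : State → State
    next (_ , _ , ε)     = c₁ , e₀ ◅ ε , w
    next (_ , p , e ◅ q) = _ , p ◅◅ (e ◅ ε) , q

    iter : ℕ → State → State
    iter zero    s = s
    iter (suc n) s = next (iter n s)

    iter-+ : ∀ m n s → iter (m + n) s ≡ iter m (iter n s)
    iter-+ zero    n s = refl
    iter-+ (suc m) n s = cong next (iter-+ m n s)

    iter-suc : ∀ n s → iter (suc n) s ≡ iter n (next s)
    iter-suc zero    s = refl
    iter-suc (suc n) s = cong next (iter-suc n s)

    branch : ℕ → V
    branch n = proj₁ (iter n (c , ε , ε))

    next-edge : ∀ s → (proj₁ s , proj₁ (next s)) ∈ A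
    next-edge (_ , _ , ε)     = e₀
    next-edge (_ , p , e ◅ q) = e

    advance : ∀ {a d} (q : Path A a d) (q′ : Path A d c) p →
              Σ ℕ λ k → Σ (Path A c d) λ p′ → iter k (a , p , q ◅◅ q′) ≡ (d , p′ , q′)
    advance ε       q′ p = 0 , p , refl
    advance (e ◅ q) q′ p = let k , p′ , h = advance q q′ (p ◅◅ (e ◅ ε)) in
      suc k , p′ , trans (iter-suc k _) h

    finish : ∀ {d} (p : Path A c d) (q : Path A d c) →
             Σ ℕ λ k → Σ (Path A c c) λ p′ → iter k (d , p , q) ≡ (c , p′ , ε)
    finish p ε       = 0 , p , refl
    finish p (e ◅ q) = let k , p′ , h = finish (p ◅◅ (e ◅ ε)) q in
      suc k , p′ , trans (iter-suc k _) h

    visits : ∀ {d} → On d w → ∀ M → Σ ℕ λ n → M ≤ n × branch n ≡ d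
    visits {d} (q , q′ , refl) M with finish (proj₁ (proj₂ (iter M (c , ε , ε)))) (proj₂ (proj₂ (iter M (c , ε , ε))))
    ... | k , p , h with advance q q′ (e₀ ◅ ε)
    -- From time `M`, `k` steps finish the current lap, one step along `e₀` begins the next, and `l`
    -- more steps reach `d`.
    ...   | l , p′ , h′ = l + suc (k + M) , ≤-trans (m≤n+m M k) (≤-trans (m≤n⇒m≤1+n ≤-refl) (m≤n+m _ l)) ,
      cong proj₁ (trans (iter-+ l (suc (k + M)) _)
        (trans (cong (iter l) (cong next (trans (iter-+ k M _) h))) h′))

  module Ranking (free cas : ℕ → V → Bool) (E : List (V × V))
    (trace : ∀ (b : ℕ → V) → (∀ n → (b n , b (suc n)) ∈ E) →
      Σ ℕ λ x → (Σ ℕ λ N → ∀ n → N ≤ n → free x (b n) ≡ true) ×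
                (∀ M → Σ ℕ λ n → M ≤ n × cas x (b n) ≡ true)) where

    -- The branch repeats a closed walk through all edges of the component, so each of their end
    -- points recurs after the moment from which x is always free.
    cycleVariable : ∀ A → A ⊆ E → ∀ {c c₁} → (c , c₁) ∈ A → Path A c₁ c →
      Σ ℕ λ x → (∀ {u v} → (u , v) ∈ A → Internal A c (u , v) → (free x u ≡ true) × (free x v ≡ true)) ×
                (Σ (V × V) λ e → e ∈ A × Internal A c e × cas x (proj₁ e) ≡ true)
    cycleVariable A A⊆E {c} e₀ p =
        x
      , (λ i int → let onu , onv = covers i int in visited (On-◅◅ʳ p onu) , visited (On-◅◅ʳ p onv))
      , (let n , _ , h = often 0
             s = iter n (c , ε , ε)
         in (branch n , branch (suc n)) , next-edge s , (proj₁ (proj₂ s) , proj₂ (proj₂ (next s))) , h)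
      where
      t = tour A c A (λ i → i)
      covers = proj₂ t
      open Cycle e₀ (p ◅◅ proj₁ t)
      tr = trace branch (λ n → A⊆E (next-edge (iter n (c , ε , ε))))
      x = proj₁ tr
      N = proj₁ (proj₁ (proj₂ tr))
      eventually = proj₂ (proj₁ (proj₂ tr))
      often = proj₂ (proj₂ tr)
      visited : ∀ {d} → On d (p ◅◅ proj₁ t) → free x d ≡ true
      visited on = let n , N≤n , e = visits on N in subst (λ d → free x d ≡ true) e (eventually n N≤n)

    StepDescent : (V → List Entry) → V → V → Set
    StepDescent μ u v = Descent (λ x → free x u ∧ free x v) (λ x → cas x u) (μ u) (μ v)

    module Level (A : List (V × V)) (c : V) (x : ℕ) where

      Comp : V → Set
      Comp u = Path A c u × Path A u c

      -- An edge without a way back lowers the rank, and one leaving a Case of the component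
      -- progresses. Both are settled at the current level; only the other edges need an inner one.
      Kept : V × V → Set
      Kept (u , v) = Path A v u × ¬ (Comp u × cas x u ≡ true)

      comp? : ∀ u → Dec (Comp u)
      comp? u = reach? A c u ×-dec reach? A u c

      kept? : ∀ e → Dec (Kept e)
      kept? (u , v) = reach? A v u ×-dec ¬? (comp? u ×-dec (cas x u Bool.≟ true))

      mark : ∀ {u} → Dec (Comp u) → Maybe ℕ
      mark (yes _) = just x
      mark (no _)  = nothing

      extend : (V → List Entry) → V → List Entry
      extend μ v = (rank A v , mark (comp? v)) ∷ μ v

      module _ (μ : V → List Entry)
               (all-free : ∀ {u v} → (u , v) ∈ A → Internal A c (u , v) →
                           (free x u ≡ true) × (free x v ≡ true))
               (rest : ∀ {u v} → (u , v) ∈ A → Kept (u , v) → StepDescent μ u v)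
               {u v : V} (i : (u , v) ∈ A) where

        Goal : ℕ → ℕ → Maybe ℕ → Maybe ℕ → Set
        Goal n n′ m m′ = Descent (λ x → free x u ∧ free x v) (λ x → cas x u)
                           ((n , m) ∷ μ u) ((n′ , m′) ∷ μ v)

        sameRank : ∀ n → Path A v u → (d : Dec (Comp u)) (d′ : Dec (Comp v)) →
                   Dec (cas x u ≡ true) → Goal n n (mark d) (mark d′)
        sameRank n p (yes (q , r)) (no ¬c) _ = ⊥-elim (¬c (q ◅◅ (i ◅ ε) , p ◅◅ r))
        sameRank n p (no ¬c) (yes (q , r)) _ = ⊥-elim (¬c (q ◅◅ p , i ◅ r))
        sameRank n p (no ¬c) (no _) _ = keep (λ ()) (rest i (p , λ k → ¬c (proj₁ k)))
        sameRank n p (yes (q , r)) (yes _) (yes h) =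
          prog (let f , f′ = all-free i (q , p ◅◅ r) in ∧-intro f f′) h
        sameRank n p (yes (q , r)) (yes _) (no ¬h) =
          keep (λ { refl → let f , f′ = all-free i (q , p ◅◅ r) in ∧-intro f f′ })
               (rest i (p , λ k → ¬h (proj₂ k)))

        descent : Dec (Path A v u) → Goal (rank A u) (rank A v) (mark (comp? u)) (mark (comp? v))
        descent (no ¬p) = lower (rank-< A i ¬p)
        descent (yes p) = subst (λ n → Goal n (rank A v) (mark (comp? u)) (mark (comp? v)))
          (≤-antisym (rank-≤ A (i ◅ ε)) (rank-≤ A p))
          (sameRank (rank A v) p (comp? u) (comp? v) (cas x u Bool.≟ true))

    ranking : ∀ k A → length A ≤ k → A ⊆ E →
      Σ ℕ λ D → Σ (V → List Entry) λ μ → (∀ v → length (μ v) ≡ D) ×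
        (∀ {u v} → (u , v) ∈ A → StepDescent μ u v)
    ranking k [] _ _ = 0 , (λ _ → []) , (λ _ → refl) , λ ()
    ranking (suc k) A@(_ ∷ _) |A|≤k A⊆E with any? (λ e → reach? A (proj₂ e) (proj₁ e)) A
    ... | no ¬cyclic = 1 , (λ v → (rank A v , nothing) ∷ []) , (λ _ → refl) ,
      λ i → lower (rank-< A i (λ p → ¬cyclic (lose i p)))
    ... | yes cyclic = suc D , extend μ , (λ v → cong suc (len v)) ,
      λ {u} {v} i → descent μ all-free (λ j k → proj₂ (proj₂ (proj₂ rec)) (∈-filter⁺ kept? j k)) i (reach? A v u)
      where
      c = proj₁ (proj₁ (find cyclic))
      c₁ = proj₂ (proj₁ (find cyclic))
      cyc = cycleVariable A A⊆E (proj₁ (proj₂ (find cyclic))) (proj₂ (proj₂ (find cyclic)))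
      x = proj₁ cyc
      all-free = proj₁ (proj₂ cyc)
      open Level A c x
      A′ = filter kept? A
      -- The branch takes some edge out of a Case on x inside the component. This edge is not kept,
      -- so the recursion on the number of edges terminates.
      smaller : length A′ < length A
      smaller = let (u , v) , i , (p , q) , h = proj₂ (proj₂ cyc) in
        filter-notAll kept? A (lose i (λ kept → proj₂ kept ((p , i ◅ q) , h)))
      rec = ranking k A′ (≤-pred (ℕₚ.<-≤-trans smaller |A|≤k)) (λ i → A⊆E (proj₁ (∈-filter⁻ kept? i)))
      D = proj₁ rec
      μ = proj₁ (proj₂ rec)
      len = proj₁ (proj₂ (proj₂ rec))

-- Stacks without repeated variables

vars : List Entry → List ℕ
vars []                   = []
vars ((n , nothing) ∷ ρ)  = vars ρ
vars ((n , just x) ∷ ρ)   = x ∷ vars ρ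

newVar : List ℕ → Maybe ℕ → Maybe ℕ
newVar X nothing = nothing
newVar X (just x) with x ∈? X
... | yes _ = nothing
... | no _  = just x

addVar : Maybe ℕ → List ℕ → List ℕ
addVar nothing  X = X
addVar (just x) X = x ∷ X

-- An induction on x must not have x among the parameters of the outer hypotheses, so a variable
-- that recurs further in is erased there.
distinctVars : List ℕ → List Entry → List Entry
distinctVars X []            = []
distinctVars X ((n , m) ∷ ρ) = (n , newVar X m) ∷ distinctVars (addVar m X) ρ

newVar-just : ∀ X m {x} → newVar X m ≡ just x → (m ≡ just x) × (x ∉ X)
newVar-just X (just y) e with y ∈? X
newVar-just X (just y) refl | no y∉X = refl , y∉X

newVar-∉ : ∀ {X x} → x ∉ X → newVar X (just x) ≡ just x
newVar-∉ {X} {x} x∉X with x ∈? X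
... | yes x∈X = ⊥-elim (x∉X x∈X)
... | no _    = refl

length-distinctVars : ∀ X ρ → length (distinctVars X ρ) ≡ length ρ
length-distinctVars X []            = refl
length-distinctVars X ((n , m) ∷ ρ) = cong suc (length-distinctVars (addVar m X) ρ)

∈-vars⁻ : ∀ {n} m {x} ρ → x ∈ vars ((n , m) ∷ ρ) → (m ≡ just x) ⊎ (x ∈ vars ρ)
∈-vars⁻ nothing  ρ i           = inj₂ i
∈-vars⁻ (just y) ρ (here refl) = inj₁ refl
∈-vars⁻ (just y) ρ (there i)   = inj₂ i

∈-addVar : ∀ m {X x} → (m ≡ just x) ⊎ (x ∈ X) → x ∈ addVar m X
∈-addVar nothing  (inj₂ i)    = i
∈-addVar (just y) (inj₁ refl) = here refl
∈-addVar (just y) (inj₂ i)    = there i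

distinctVars-∉ : ∀ X ρ σ {n x ρ′} → distinctVars X ρ ≡ σ ++ (n , just x) ∷ ρ′ →
                 (x ∉ X) × (x ∉ vars σ)
distinctVars-∉ X [] [] ()
distinctVars-∉ X [] (_ ∷ _) ()
distinctVars-∉ X ((n , m) ∷ ρ) [] e = proj₂ (newVar-just X m (cong proj₂ (∷-injectiveˡ e))) , λ ()
distinctVars-∉ X ((n , m) ∷ ρ) (_ ∷ σ) {x = x} e with ∷-injective e
... | refl , e′ with distinctVars-∉ (addVar m X) ρ σ e′
...   | x∉ , x∉σ = (λ i → x∉ (∈-addVar m (inj₂ i))) , λ i → head (∈-vars⁻ (newVar X m) σ i)
  where
  head : (newVar X m ≡ just x) ⊎ (x ∈ vars σ) → ⊥
  head (inj₁ h) = x∉ (∈-addVar m (inj₁ (proj₁ (newVar-just X m h))))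
  head (inj₂ i) = x∉σ i

-- The variables in `X` have not passed a Case, so progress further in is never on an erased
-- variable. To maintain this, a `keep` whose variable did pass a Case is turned into `prog`.
distinctVars-Descent : ∀ {F K} X {ρ ρ′} → (∀ {x} → x ∈ X → K x ≡ false) → Descent F K ρ ρ′ →
                       Descent F K (distinctVars X ρ) (distinctVars X ρ′)
distinctVars-Descent X h (lower l) = lower l
distinctVars-Descent {F} {K} X h (prog {n = n} {x} {ρ} {ρ′} f k) =
  subst (λ m → Descent F K ((n , m) ∷ distinctVars (x ∷ X) ρ) ((n , m) ∷ distinctVars (x ∷ X) ρ′))
    (sym (newVar-∉ (λ i → ff≢tt (trans (sym (h i)) k)))) (prog f k)
distinctVars-Descent X h (keep {m = nothing} f d) = keep (λ ()) (distinctVars-Descent X h d)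
distinctVars-Descent {F} {K} X h (keep {n = n} {m = just x} {ρ} {ρ′} f d) with K x in k
... | true  = subst (λ m → Descent F K ((n , m) ∷ distinctVars (x ∷ X) ρ) ((n , m) ∷ distinctVars (x ∷ X) ρ′))
                (sym (newVar-∉ (λ i → ff≢tt (trans (sym (h i)) k)))) (prog (f refl) k)
... | false = keep (λ e → f (proj₁ (newVar-just X (just x) e)))
                (distinctVars-Descent (x ∷ X) (λ { (here refl) → k ; (there i) → h i }) d)

-- The graph of proof nodes

freeIn : ℕ → Maybe Node → Bool
freeIn x nothing        = false
freeIn x (just (s , _)) = freeSeq x s

isVar : Maybe ℕ → ℕ → Bool
isVar nothing  x = false
isVar (just y) x = y ≡ᵇ x

caseIn : ℕ → Maybe Node → Bool
caseIn x (just (_ , node r _)) = isVar (caseVar r) x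
caseIn x (just (_ , bud _ _))  = false
caseIn x nothing               = false

successors : Address → Maybe Node → List Address
successors a nothing                      = []
successors a (just (_ , bud _ c))         = c ∷ []
successors a (just (_ , node {ps} _ _))   = map (a ∷ʳ_) (upTo (length ps))

mutual
  addresses : ∀ {s} → PT s → List Address
  addresses (bud _ _)   = [] ∷ []
  addresses (node _ ts) = [] ∷ childAddresses 0 ts

  childAddresses : ∀ {ps} → ℕ → All PT ps → List Address
  childAddresses i []       = []
  childAddresses i (t ∷ ts) = map (i ∷_) (addresses t) ++ childAddresses (suc i) ts

mutual
  ∈-addresses : ∀ {s} (t : PT s) a {n} → sub t a ≡ just n → a ∈ addresses t
  ∈-addresses (bud _ _)   []      e = here refl
  ∈-addresses (node _ ts) []      e = here refl
  ∈-addresses (node _ ts) (j ∷ a) e = there (∈-childAddresses ts 0 j a e)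

  ∈-childAddresses : ∀ {ps} (ts : All PT ps) i j a {n} → subs ts j a ≡ just n →
                     (i + j ∷ a) ∈ childAddresses i ts
  ∈-childAddresses (t ∷ ts) i zero    a e rewrite +-identityʳ i =
    ∈-++⁺ˡ (∈-map⁺ (i ∷_) (∈-addresses t a e))
  ∈-childAddresses (t ∷ ts) i (suc j) a e rewrite +-suc i j =
    ∈-++⁺ʳ (map (i ∷_) (addresses t)) (∈-childAddresses ts (suc i) j a e)

mutual
  sub-∷ʳ : ∀ {s} (t : PT s) a i {s′ ps} {r : CRule ps s′} {ts : All PT ps} →
           sub t a ≡ just (s′ , node r ts) → sub t (a ∷ʳ i) ≡ subs ts i []
  sub-∷ʳ (node r ts) [] i refl = refl
  sub-∷ʳ (node r ts) (j ∷ a) i e = subs-∷ʳ ts j a i e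

  subs-∷ʳ : ∀ {qs} (us : All PT qs) j a i {s′ ps} {r : CRule ps s′} {ts : All PT ps} →
            subs us j a ≡ just (s′ , node r ts) → subs us j (a ∷ʳ i) ≡ subs ts i []
  subs-∷ʳ (u ∷ us) zero    a i e = sub-∷ʳ u a i e
  subs-∷ʳ (u ∷ us) (suc j) a i e = subs-∷ʳ us j a i e

subs-< : ∀ {ps} (ts : All PT ps) {i} → i < length ps → Σ Node λ n → subs ts i [] ≡ just n
subs-< (t ∷ ts) {zero}  h       = (_ , t) , refl
subs-< (t ∷ ts) {suc i} (s≤s h) = subs-< ts h

subs-child : ∀ {ps} (ts : All PT ps) i a {n} → subs ts i a ≡ just n →
             (i < length ps) × Σ Node λ m → (subs ts i [] ≡ just m) × (sub (proj₂ m) a ≡ just n)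
subs-child (t ∷ ts) zero    a e = s≤s z≤n , (_ , t) , refl , e
subs-child (t ∷ ts) (suc i) a e = let l , m , h = subs-child ts i a e in s≤s l , m , h

module StepGraph {s : Seq} (π : PT s) where

  private
    next : Address → List Address
    next a = successors a (sub π a)

  edges : List (Address × Address)
  edges = concatMap (λ a → map (a ,_) (next a)) (addresses π)

  edge⁺ : ∀ {a b n} → sub π a ≡ just n → b ∈ successors a (just n) → (a , b) ∈ edges
  edge⁺ {a} {b} e i = ∈-concatMap⁺ (λ a → map (a ,_) (next a))
    (lose (∈-addresses π a e) (∈-map⁺ (a ,_) (subst (λ m → b ∈ successors a m) (sym e) i)))

  edge⁻ : ∀ {a b} → (a , b) ∈ edges → b ∈ successors a (sub π a)
  edge⁻ i with find (∈-concatMap⁻ (λ a → map (a ,_) (next a)) {xs = addresses π} i)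
  ... | a , _ , j with ∈-map⁻ (a ,_) j
  ...   | _ , k , refl = k

  child-edge : ∀ {a s′ ps} {r : CRule ps s′} {ts : All PT ps} i → sub π a ≡ just (s′ , node r ts) →
               i < length ps → (a , a ∷ʳ i) ∈ edges
  child-edge {a} i e l = edge⁺ e (∈-map⁺ (a ∷ʳ_) (∈-upTo⁺ l))

  edge⇒Step : ∀ {a b} → (a , b) ∈ edges → Step π a b
  edge⇒Step {a} {b} i = go (sub π a) refl (edge⁻ i)
    where
    go : ∀ m → sub π a ≡ m → b ∈ successors a m → Step π a b
    go (just (_ , bud s′ c)) e (here refl) = back a s′ c e
    go (just (_ , node {ps} r ts)) e j with ∈-map⁻ (a ∷ʳ_) j
    ... | k , l , refl = let n , h = subs-< ts (∈-upTo⁻ l) in child a k n (trans (sub-∷ʳ π a k e) h)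

  open Graph {V = Address} (≡-dec ℕ._≟_) public

  reachable : ∀ a {n} → sub π a ≡ just n → Path edges [] a
  reachable a = go a [] refl
    where
    go : ∀ b a {m} → sub π a ≡ just m → ∀ {n} → sub (proj₂ m) b ≡ just n → Path edges a (a ++ b)
    go [] a e h = subst (Path edges a) (sym (++-identityʳ a)) ε
    go (i ∷ b) a {_ , node r ts} e h with subs-child ts i b h
    ... | l , m , h₁ , h₂ = child-edge i e l ◅
      subst (Path edges (a ∷ʳ i)) (++-assoc a (i ∷ []) b) (go b (a ∷ʳ i) (trans (sub-∷ʳ π a i e) h₁) h₂)

  free cas : ℕ → Address → Bool
  free x a = freeIn x (sub π a)
  cas x a = caseIn x (sub π a)

  Good : (ℕ → Address) → Set
  Good b = Σ ℕ λ x → (Σ ℕ λ N → ∀ n → N ≤ n → free x (b n) ≡ true) ×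
                     (∀ M → Σ ℕ λ n → M ≤ n × cas x (b n) ≡ true)

  cons : Address → (ℕ → Address) → ℕ → Address
  cons u b zero    = u
  cons u b (suc n) = b n

  Good-tail : ∀ u b → Good (cons u b) → Good b
  Good-tail u b (x , (N , f) , often) = x , (N , λ n l → f (suc n) (m≤n⇒m≤1+n l)) , drop
    where
    drop : ∀ M → Σ ℕ λ n → M ≤ n × cas x (b n) ≡ true
    drop M with often (suc M)
    ... | suc n , s≤s l , h = n , l , h

  -- The trace condition speaks of branches from the root, whereas the ranking needs branches from
  -- any node. They are extended backwards, and goodness survives the removal of the added initial
  -- segment.
  prepend : ∀ {u v} → Path edges u v → ∀ b → b 0 ≡ v → (∀ n → (b n , b (suc n)) ∈ edges) →
            Σ (ℕ → Address) λ b′ → (b′ 0 ≡ u) × (∀ n → (b′ n , b′ (suc n)) ∈ edges) × (Good b′ → Good b)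
  prepend ε b e st = b , e , st , λ g → g
  prepend {u} (i ◅ p) b e st with prepend p b e st
  ... | b′ , refl , st′ , tail = cons u b′ , refl , (λ { zero → i ; (suc n) → st′ n }) ,
    λ g → tail (Good-tail u b′ g)

  module _ (cha : CHAProof π) where

    goodBranch : ∀ b → (∀ n → (b n , b (suc n)) ∈ edges) → Good b
    goodBranch b st with sub π (b 0) in e | edge⁻ (st 0)
    ... | just n | _ with prepend (reachable (b 0) e) b refl st
    ...   | b′ , e′ , st′ , back′ with proj₂ cha b′ (e′ , λ n → edge⇒Step (st′ n))
    ...     | x , (N , f) , often = back′ (x , (N , λ n l → freeAt (b′ n) (f n l)) ,
                λ M → let n , l , h = often M in n , l , caseAt (b′ n) h)
      where
      freeAt : ∀ a → FreeAt π x a → free x a ≡ true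
      freeAt a (_ , h , h′) = trans (cong (freeIn x) h) h′
      caseAt : ∀ a → CaseAt π x a → cas x a ≡ true
      caseAt a (_ , _ , r , _ , h , h′) = trans (cong (caseIn x) h) (trans (cong (λ m → isVar m x) h′) (≡ᵇ-refl x))

    stacks : Σ ℕ λ D → Σ (Address → List Entry) λ μ → (∀ a → length (μ a) ≡ D) ×
      (∀ {a b} → (a , b) ∈ edges →
         Descent (λ x → free x a ∧ free x b) (λ x → cas x a) (μ a) (μ b)) ×
      (∀ a σ {n x ρ} → μ a ≡ σ ++ (n , just x) ∷ ρ → x ∉ vars σ)
    stacks with Ranking.ranking free cas edges goodBranch (length edges) edges ≤-refl (λ i → i)
    ... | D , μ , len , desc = D , (λ a → distinctVars [] (μ a)) ,
      (λ a → trans (length-distinctVars [] (μ a)) (len a)) ,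
      (λ i → distinctVars-Descent [] (λ ()) (desc i)) ,
      λ a σ e → proj₂ (distinctVars-∉ [] (μ a) σ e)

freeL⇒∈ : ∀ z Γ → freeL z Γ ≡ true → Σ (Formula 0) λ φ → (φ ∈ Γ) × (freeF z φ ≡ true)
freeL⇒∈ z (φ ∷ Γ) h with ∨-true (freeF z φ) h
... | inj₁ e = φ , here refl , e
... | inj₂ e = let χ , i , e′ = freeL⇒∈ z Γ e in χ , there i , e′

-- The translation

closeAll : List ℕ → Formula 0 → Formula 0
closeAll ys φ = foldr (λ y χ → all[ y ] χ) φ ys

free-closeAll : ∀ z ys φ → freeF z (closeAll ys φ) ≡ true → (freeF z φ ≡ true) × (z ∉ ys)
free-closeAll z []       φ h = h , λ ()
free-closeAll z (y ∷ ys) φ h with freeF-closeF z y (closeAll ys φ) h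
... | h′ , z≢y with free-closeAll z ys φ h′
...   | h″ , z∉ys = h″ , λ { (here e) → z≢y e ; (there i) → z∉ys i }

Pi-closeAll : ∀ {Q} ys {φ} → Pi Q φ → Pi Q (closeAll ys φ)
Pi-closeAll []       p = p
Pi-closeAll (y ∷ ys) p = pall y (Pi-closeAll ys p)

∈-vars⇒Any : ∀ {x} ρ → x ∈ vars ρ → Any (λ e → proj₂ e ≡ just x) ρ
∈-vars⇒Any ((n , m) ∷ ρ) i with ∈-vars⁻ m ρ i
... | inj₁ e = here e
... | inj₂ j = there (∈-vars⇒Any ρ j)

Any⇒∈-vars : ∀ {x} ρ → Any (λ e → proj₂ e ≡ just x) ρ → x ∈ vars ρ
Any⇒∈-vars ((n , just x) ∷ ρ)  (here refl) = here refl
Any⇒∈-vars ((n , nothing) ∷ ρ) (there i)   = Any⇒∈-vars ρ i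
Any⇒∈-vars ((n , just y) ∷ ρ)  (there i)   = there (Any⇒∈-vars ρ i)

∈-vars-reverse : ∀ {x} ρ → x ∈ vars ρ → x ∈ vars (reverse ρ)
∈-vars-reverse ρ i = Any⇒∈-vars (reverse ρ) (reverse⁺ (∈-vars⇒Any ρ i))

ʳ++-cancelˡ : ∀ {A : Set} (σ : List A) {ρ ρ′} → σ ʳ++ ρ ≡ σ ʳ++ ρ′ → ρ ≡ ρ′
ʳ++-cancelˡ []      e = e
ʳ++-cancelˡ (_ ∷ σ) e = ∷-injectiveʳ (ʳ++-cancelˡ σ e)

-- Prefixes of stacks are kept in reverse, innermost entry first.
Extends : List Entry → List Entry → Set
Extends σ ρ₀ = Σ (List Entry) λ ρ → ρ₀ ≡ σ ʳ++ ρ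

extends? : ∀ σ ρ₀ → Dec (Extends σ ρ₀)
extends? [] ρ₀ = yes (ρ₀ , refl)
extends? (e ∷ σ) ρ₀ with extends? σ ρ₀
... | no ¬p = no λ (ρ , h) → ¬p (e ∷ ρ , h)
... | yes ([] , h) = no λ (ρ , h′) → []≢∷ (ʳ++-cancelˡ σ (trans (sym h) h′))
  where
  []≢∷ : {ρ : List Entry} → [] ≢ e ∷ ρ
  []≢∷ ()
... | yes (e′ ∷ ρ , h) with Productₚ.≡-dec ℕ._≟_ (Maybeₚ.≡-dec ℕ._≟_) e e′
...   | yes refl = yes (ρ , h)
...   | no e≢e′  = no λ (ρ′ , h′) → e≢e′ (sym (∷-injectiveˡ (ʳ++-cancelˡ σ (trans (sym h) h′))))

nodeSeq : Maybe Node → Seq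
nodeSeq nothing        = [] ⇒ `⊥
nodeSeq (just (s , _)) = s

budTarget : Maybe Node → List Address
budTarget (just (_ , bud _ c)) = c ∷ []
budTarget _                    = []

module Translation (Θ : Formula 0 → Set) {s₀ : Seq} (π : PT s₀) (pre : PreProof π)
  (inΘ : BudsCompanionsIn Θ π)
  (D : ℕ) (μ : Address → List Entry) (len : ∀ a → length (μ a) ≡ D)
  (step-descent : ∀ {a b} → (a , b) ∈ StepGraph.edges π →
    Descent (λ x → StepGraph.free π x a ∧ StepGraph.free π x b) (λ x → StepGraph.cas π x a) (μ a) (μ b))
  (distinct : ∀ a σ {n x ρ} → μ a ≡ σ ++ (n , just x) ∷ ρ → x ∉ vars σ) where

  open StepGraph π
  open Induction (λ φ → Pi (ImpSet Θ) φ ⊎ Δ0 φ) inj₂ (ImpSet Θ) inj₁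

  ⋀E : ∀ Φ {Γ φ} → Γ ⊢ ⋀ Φ → φ ∈ Φ → Γ ⊢ φ
  ⋀E (φ ∷ [])    p (here refl) = p
  ⋀E (φ ∷ ψ ∷ Φ) p (here refl) = ∧E₁ p
  ⋀E (φ ∷ ψ ∷ Φ) p (there i)   = ⋀E (ψ ∷ Φ) (∧E₂ p) i

  ⋀I : ∀ Φ {Γ} → (∀ {φ} → φ ∈ Φ → Γ ⊢ φ) → Γ ⊢ ⋀ Φ
  ⋀I []          h = ⊃I hyp₀
  ⋀I (φ ∷ [])    h = h (here refl)
  ⋀I (φ ∷ ψ ∷ Φ) h = ∧I (h (here refl)) (⋀I (ψ ∷ Φ) (λ i → h (there i)))

  closeAllE : ∀ ys {Γ φ} → Γ ⊢ closeAll ys φ → Γ ⊢ φ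
  closeAllE []       p = p
  closeAllE (y ∷ ys) p = closeAllE ys (allE-self y p)

  closeAllI : ∀ ys {Γ φ} → (∀ {y} → y ∈ ys → freeL y Γ ≡ false) → Γ ⊢ φ → Γ ⊢ closeAll ys φ
  closeAllI []       h p = p
  closeAllI (y ∷ ys) h p = allI y (h (here refl)) (closeAllI ys (λ i → h (there i)) p)

  companions : List Address
  companions = concatMap (λ a → budTarget (sub π a)) (addresses π)

  seqAt : Address → Seq
  seqAt a = nodeSeq (sub π a)

  companion⁺ : ∀ {a s c} → sub π a ≡ just (s , bud s c) → c ∈ companions
  companion⁺ {a} {s} {c} e = ∈-concatMap⁺ (λ a → budTarget (sub π a))
    (lose (∈-addresses π a e) (subst (λ m → c ∈ budTarget m) (sym e) (here refl)))

  companion⁻ : ∀ {c} → c ∈ companions → Σ (PT (seqAt c)) λ t →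
               sub π c ≡ just (seqAt c , t) × SeqIn Θ (seqAt c)
  companion⁻ {c} i with find (∈-concatMap⁻ (λ a → budTarget (sub π a)) {xs = addresses π} i)
  ... | a , _ , j = go (sub π a) refl j
    where
    go : ∀ m → sub π a ≡ m → c ∈ budTarget m →
         Σ (PT (seqAt c)) λ t → sub π c ≡ just (seqAt c , t) × SeqIn Θ (seqAt c)
    go (just (_ , bud s c)) e (here refl) with pre a s c e
    ... | _ , r , ts , h , _ = subst
      (λ s′ → Σ (PT s′) λ t → sub π c ≡ just (s′ , t) × SeqIn Θ s′)
      (sym (cong nodeSeq h)) (node r ts , h , proj₁ (inΘ a s c e))

  bud-seqAt : ∀ {a s c} → sub π a ≡ just (s , bud s c) → seqAt c ≡ s
  bud-seqAt {a} {s} {c} e with pre a s c e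
  ... | _ , _ , _ , h , _ = cong nodeSeq h

  seqImp : Address → Formula 0
  seqImp c = ⋀ (ctx (seqAt c)) ⊃ goal (seqAt c)

  -- All names below the bound are taken, occurring or not: vacuous quantifiers do no harm and spare
  -- the computation of the free names.
  closedNames : List ℕ → Formula 0 → List ℕ
  closedNames X φ = filter (λ y → ¬? (y ∈? X)) (upTo (boundF φ))

  ψ : List ℕ → Address → Formula 0
  ψ X c = closeAll (closedNames X (seqImp c)) (seqImp c)

  free-ψ : ∀ z X c → freeF z (ψ X c) ≡ true → z ∈ X
  free-ψ z X c h with z ∈? X | free-closeAll z (closedNames X (seqImp c)) (seqImp c) h
  ... | yes z∈X | _ = z∈X
  ... | no z∉X  | h′ , z∉ = ⊥-elim (z∉ (∈-filter⁺ (λ y → ¬? (y ∈? X)) (∈-upTo⁺ (freeF-bound z (seqImp c) h′)) z∉X))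

  ψE : ∀ X c {Γ} → Γ ⊢ ψ X c → Γ ⊢ seqImp c
  ψE X c = closeAllE (closedNames X (seqImp c))

  ψI : ∀ X c {Γ} → (∀ z → freeL z Γ ≡ true → z ∈ X) → Γ ⊢ seqImp c → Γ ⊢ ψ X c
  ψI X c h = closeAllI (closedNames X (seqImp c)) (λ {y} i → ¬true⇒false λ e →
    proj₂ (∈-filter⁻ (λ y → ¬? (y ∈? X)) {xs = upTo (boundF (seqImp c))} i) (h y e))

  Pi-ψ : ∀ X {c} → c ∈ companions → Pi (ImpSet Θ) (ψ X c)
  Pi-ψ X {c} i = let _ , _ , θΓ , θδ = companion⁻ i in
    Pi-closeAll (closedNames X (seqImp c)) (base (imp (ctx (seqAt c)) (goal (seqAt c)) θΓ θδ))

  group : List Entry → List Address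
  group σ = filter (λ c → extends? σ (μ c)) companions

  group⁺ : ∀ σ {c ρ} → c ∈ companions → μ c ≡ σ ʳ++ ρ → c ∈ group σ
  group⁺ σ {ρ = ρ} i e = ∈-filter⁺ (λ c → extends? σ (μ c)) i (ρ , e)

  group⁻ : ∀ σ {c} → c ∈ group σ → (c ∈ companions) × Extends σ (μ c)
  group⁻ σ = ∈-filter⁻ (λ c → extends? σ (μ c)) {xs = companions}

  hyps : List Entry → ℕ → Term 0 → List (Formula 0)
  hyps σ x t = belows x (map (ψ (vars σ)) (group σ)) t

  hyps⁺ : ∀ σ x t {c ρ} → c ∈ companions → μ c ≡ σ ʳ++ ρ → below (ψ (vars σ) c) x t ∈ hyps σ x t
  hyps⁺ σ x t i e = ∈-map⁺ (λ φ → below φ x t) (∈-map⁺ (ψ (vars σ)) (group⁺ σ i e))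

  hyps⁻ : ∀ σ x t {χ} → χ ∈ hyps σ x t →
          Σ Address λ c → (c ∈ group σ) × (χ ≡ below (ψ (vars σ) c) x t)
  hyps⁻ σ x t i with ∈-map⁻ (λ φ → below φ x t) i
  ... | _ , j , refl with ∈-map⁻ (ψ (vars σ)) j
  ...   | c , k , refl = c , k , refl

  free-hyps : ∀ z σ x t {χ} → χ ∈ hyps σ x t → freeF z χ ≡ true → (freeT z t ≡ true) ⊎ (z ∈ vars σ)
  free-hyps z σ x t i h with hyps⁻ σ x t i
  ... | c , _ , refl with free-below z (ψ (vars σ) c) x t h
  ...   | inj₁ e       = inj₁ e
  ...   | inj₂ (e , _) = inj₂ (free-ψ z (vars σ) c e)

  -- The induction hypotheses for all variables of the reversed prefix σ.
  full : List Entry → List (Formula 0)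
  full []                         = []
  full ((n , nothing) ∷ σ)        = full σ
  full σ@((n , just x) ∷ σ′)      = hyps σ x (var x) ++ full σ′

  -- The induction hypotheses available after a path along which exactly the names in F stayed
  -- free and the names in K passed a Case; ρ are the entries below the reversed prefix σ.
  available : List Entry → List Entry → (F K : ℕ → Bool) → List (Formula 0)
  availableVar : List Entry → ℕ → List Entry → (F K : ℕ → Bool) → Bool → Bool → List (Formula 0)
  available σ []                  F K = []
  available σ ((n , nothing) ∷ ρ) F K = available ((n , nothing) ∷ σ) ρ F K
  available σ ((n , just x) ∷ ρ)  F K = availableVar ((n , just x) ∷ σ) x ρ F K (F x) (K x)
  availableVar σ x ρ F K false _     = []
  availableVar σ x ρ F K true  true  = hyps σ x (`S (var x))
  availableVar σ x ρ F K true  false = hyps σ x (var x) ++ available σ ρ F K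

  free-full : ∀ z σ → freeL z (full σ) ≡ true → z ∈ vars σ
  free-full z ((n , nothing) ∷ σ) h = free-full z σ h
  free-full z ((n , just x) ∷ σ) h with ∨-true (freeL z H) (trans (sym (freeL-++ z H)) h)
    where H = hyps ((n , just x) ∷ σ) x (var x)
  ... | inj₂ h′ = there (free-full z σ h′)
  ... | inj₁ h′ with freeL⇒∈ z (hyps ((n , just x) ∷ σ) x (var x)) h′
  ...   | φ , i , e with free-hyps z ((n , just x) ∷ σ) x (var x) i e
  ...     | inj₁ e′ rewrite ≡ᵇ-true z x e′ = here refl
  ...     | inj₂ j = j

  -- Provides the condition of `ruleInContext` on the side context, because a walk keeps `F` within
  -- the free names of the current sequent.
  free-available : ∀ z σ ρ F K → (∀ {y} → y ∈ vars σ → F y ≡ true) →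
                   ∀ {χ} → χ ∈ available σ ρ F K → freeF z χ ≡ true → F z ≡ true
  free-available z σ ((n , nothing) ∷ ρ) F K hσ i h = free-available z ((n , nothing) ∷ σ) ρ F K hσ i h
  free-available z σ ((n , just x) ∷ ρ) F K hσ i h with F x in fx | K x
  ... | true | true = fromHyps (free-hyps z ((n , just x) ∷ σ) x (`S (var x)) i h)
    where
    fromHyps : (freeT {0} z (var x) ≡ true) ⊎ (z ∈ x ∷ vars σ) → F z ≡ true
    fromHyps (inj₁ e) rewrite ≡ᵇ-true z x e = fx
    fromHyps (inj₂ (here refl)) = fx
    fromHyps (inj₂ (there j))   = hσ j
  ... | true | false with ∈-++⁻ (hyps ((n , just x) ∷ σ) x (var x)) i
  ...   | inj₂ j = free-available z ((n , just x) ∷ σ) ρ F K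
                     (λ { (here refl) → fx ; (there k) → hσ k }) j h
  ...   | inj₁ j with free-hyps z ((n , just x) ∷ σ) x (var x) j h
  ...     | inj₁ e rewrite ≡ᵇ-true z x e = fx
  ...     | inj₂ (here refl) = fx
  ...     | inj₂ (there k)   = hσ k

  -- Lets the hypotheses of a premise be weakened to those of the conclusion. Agreement of `K` is
  -- required only where `F′` holds, which also admits the zero premise of a Case.
  available-mono : ∀ σ ρ {F K F′ K′} → (∀ {y} → F′ y ≡ true → F y ≡ true) →
                   (∀ {y} → F′ y ≡ true → K′ y ≡ K y) → available σ ρ F′ K′ ⊆ available σ ρ F K
  available-mono σ [] f k i = i
  available-mono σ ((n , nothing) ∷ ρ) f k i = available-mono ((n , nothing) ∷ σ) ρ f k i
  available-mono σ ((n , just x) ∷ ρ) {F} {K} {F′} {K′} f k i with F′ x in fx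
  ... | true rewrite f fx | k fx with K x
  ...   | true  = i
  ...   | false = ++⁺ ⊆-refl (available-mono ((n , just x) ∷ σ) ρ f k) i

  full-ʳ++ : ∀ ρ σ → full σ ⊆ full (ρ ʳ++ σ)
  full-ʳ++ [] σ i = i
  full-ʳ++ ((n , nothing) ∷ ρ) σ i = full-ʳ++ ρ ((n , nothing) ∷ σ) i
  full-ʳ++ ((n , just x) ∷ ρ) σ i =
    full-ʳ++ ρ ((n , just x) ∷ σ) (∈-++⁺ʳ (hyps ((n , just x) ∷ σ) x (var x)) i)

  available⊆full : ∀ ρ σ F → available σ ρ F (λ _ → false) ⊆ full (ρ ʳ++ σ)
  available⊆full ((n , nothing) ∷ ρ) σ F i = available⊆full ρ ((n , nothing) ∷ σ) F i
  available⊆full ((n , just x) ∷ ρ) σ F i with F x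
  ... | true with ∈-++⁻ (hyps ((n , just x) ∷ σ) x (var x)) i
  ...   | inj₁ j = full-ʳ++ ρ ((n , just x) ∷ σ) (∈-++⁺ˡ j)
  ...   | inj₂ j = available⊆full ρ ((n , just x) ∷ σ) F j

  hyps-unchanged : ∀ n σ {x y u} → y ≢ x → x ∉ vars σ → ∀ t → freeT x t ≢ true →
                   ∀ {χ} → χ ∈ hyps ((n , just y) ∷ σ) y t → substF x u χ ≡ χ
  hyps-unchanged n σ {x} {y} y≢x x∉ t x∉t {χ} i = substF-fresh x _ χ (¬true⇒false λ e →
      notIn (free-hyps x ((n , just y) ∷ σ) y t i e))
    where
    notIn : ¬ ((freeT x t ≡ true) ⊎ (x ∈ y ∷ vars σ))
    notIn (inj₁ e)           = x∉t e
    notIn (inj₂ (here refl)) = y≢x refl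
    notIn (inj₂ (there j))   = x∉ j

  -- Levels outside that of `x` do not contain `x`. At its own level the substitution raises the
  -- bound x to Sx, or Sx to SSx, which is then lowered to Sx again. Levels further in are no longer
  -- claimed, since `K′ x` holds.
  available-case : ∀ x σ ρ {F K F′ K′} → x ∉ vars σ → (∀ {y} → F′ y ≡ true → F y ≡ true) →
    (∀ {y} → y ≢ x → K′ y ≡ K y) → K′ x ≡ true →
    ∀ {Γ} → (∀ {χ} → χ ∈ available σ ρ F K → Γ ⊢ substF x (`S (var x)) χ) →
    ∀ {χ} → χ ∈ available σ ρ F′ K′ → Γ ⊢ χ
  available-case x σ ((n , nothing) ∷ ρ) x∉ f k kx h i =
    available-case x ((n , nothing) ∷ σ) ρ x∉ f k kx h i
  available-case x σ ((n , just y) ∷ ρ) {F} {K} {F′} {K′} x∉ f k kx {Γ} h i with F′ y in fy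
  ... | true rewrite f fy with y ℕ.≟ x
  ...   | yes refl rewrite kx with hyps⁻ ((n , just x) ∷ σ) x (`S (var x)) i | K x
  ...     | c , j , refl | true = below-mono (ψ (x ∷ vars σ) c) x (`S (`S (var x))) (`S (var x))
              (λ z → <-step hyp₀)
              (subst (Γ ⊢_) e (h (∈-map⁺ (λ φ → below φ x (`S (var x))) (∈-map⁺ (ψ (x ∷ vars σ)) j))))
    where
    e : substF x (`S (var x)) (below (ψ (x ∷ vars σ) c) x (`S (var x))) ≡
        below (ψ (x ∷ vars σ) c) x (`S (`S (var x)))
    e = trans (substF-below x (`S (var x)) (ψ (x ∷ vars σ) c) x (`S (var x)) (closeF-notfree x (ψ (x ∷ vars σ) c)))
          (cong (λ t → below (ψ (x ∷ vars σ) c) x (`S t)) (substT-var-self x (`S (var x))))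
  ...     | c , j , refl | false =
              subst (Γ ⊢_) e (h (∈-++⁺ˡ (∈-map⁺ (λ φ → below φ x (var x)) (∈-map⁺ (ψ (x ∷ vars σ)) j))))
    where
    e : substF x (`S (var x)) (below (ψ (x ∷ vars σ) c) x (var x)) ≡
        below (ψ (x ∷ vars σ) c) x (`S (var x))
    e = trans (substF-below x (`S (var x)) (ψ (x ∷ vars σ) c) x (var x) (closeF-notfree x (ψ (x ∷ vars σ) c)))
          (cong (below (ψ (x ∷ vars σ) c) x) (substT-var-self x (`S (var x))))
  available-case x σ ((n , just y) ∷ ρ) {F} {K} {F′} {K′} x∉ f k kx {Γ} h i
      | true | no y≢x rewrite k y≢x with K y
  ...   | true = subst (Γ ⊢_) (hyps-unchanged n σ y≢x x∉ (`S (var y)) (λ e → y≢x (sym (≡ᵇ-true x y e))) i) (h i)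
  ...   | false with ∈-++⁻ (hyps ((n , just y) ∷ σ) y (var y)) i
  ...     | inj₁ j = subst (Γ ⊢_) (hyps-unchanged n σ y≢x x∉ (var y) (λ e → y≢x (sym (≡ᵇ-true x y e))) j) (h (∈-++⁺ˡ j))
  ...     | inj₂ j = available-case x ((n , just y) ∷ σ) ρ
      (λ { (here refl) → y≢x refl ; (there l) → x∉ l }) f k kx
      (λ l → h (∈-++⁺ʳ (hyps ((n , just y) ∷ σ) y (var y)) l)) j

  -- The invariant and the treatment of buds are left open because the traversal is used twice:
  -- below a companion with its stack of hypotheses, and from the root with none.
  module Walk (ρ₀ : List Entry) (Inv : Address → (F K : ℕ → Bool) → Set)
    (inv-step : ∀ {a b F K} → Inv a F K → (a , b) ∈ edges →
                Inv b (λ x → F x ∧ free x b) (λ x → K x ∨ cas x a))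
    (inv-bud : ∀ {a s c F K} → Inv a F K → sub π a ≡ just (s , bud s c) →
               available [] ρ₀ F K ⊢ seqImp c) where

    Children : ∀ {ps} → Address → All PT ps → Set
    Children a ts = ∀ i {n} → subs ts i [] ≡ just n → Σ Address λ b → (a , b) ∈ edges × sub π b ≡ just n

    children : ∀ {a s ps} {r : CRule ps s} {ts : All PT ps} → sub π a ≡ just (s , node r ts) → Children a ts
    children {a} {ts = ts} e i h =
      a ∷ʳ i , child-edge i e (proj₁ (subs-child ts i [] h)) , trans (sub-∷ʳ π a i e) h

    mutual
      walk : ∀ {s} (t : PT s) {a} F K → sub π a ≡ just (s , t) →
             (∀ {x} → F x ≡ true → freeSeq x s ≡ true) → Inv a F K →
             ctx s ++ available [] ρ₀ F K ⊢ goal s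
      walk (bud s c) {a} F K e f inv = ⊃E
        (weaken (∈-++⁺ʳ (ctx s))
          (subst (λ s′ → available [] ρ₀ F K ⊢ ⋀ (ctx s′) ⊃ goal s′) (bud-seqAt {a} e) (inv-bud {a} inv e)))
        (⋀I (ctx s) (λ i → assume (∈-++⁺ˡ i)))
      walk (node (base r) ts) {a} F K e f inv = ruleInContext r (available [] ρ₀ F K)
        (λ z h → let _ , i , h′ = freeL⇒∈ z (available [] ρ₀ F K) h in
                 f (free-available z [] ρ₀ F K (λ ()) i h′))
        (walks ts F K (λ x → cong (caseIn x) e) inv (children e))
      walk (node (case {Γ} {δ} x) (t₀ ∷ t₁ ∷ [])) {a} F K e f inv
        with children e 0 refl | children e 1 refl
      ... | b₀ , i₀ , e₀ | b₁ , i₁ , e₁ = caseRule x (Γ ++ available [] ρ₀ F K) δ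
          (subst (_⊢ substF x `0 δ) (sym (map-++ (substF x `0) Γ A))
            (weaken (++⁺ (⊆-refl {x = map (substF x `0) Γ}) zeroCtx) left))
          (subst (_⊢ substF x (`S (var x)) δ) (sym (map-++ (substF x (`S (var x))) Γ A))
            (cutAll A₁ (λ i → weaken (∈-++⁺ʳ ΓS) (sucCtx i)) (weaken reorder right)))
        where
        A = available [] ρ₀ F K
        F₀ F₁ K′ : ℕ → Bool
        F₀ y = F y ∧ free y b₀
        F₁ y = F y ∧ free y b₁
        K′ y = K y ∨ cas y a
        A₀ = available [] ρ₀ F₀ K′
        A₁ = available [] ρ₀ F₁ K′
        ΓS = map (substF x (`S (var x))) Γ
        cas-a : ∀ y → cas y a ≡ (x ≡ᵇ y)
        cas-a y = cong (caseIn y) e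
        K′-other : ∀ {y} → y ≢ x → K′ y ≡ K y
        K′-other {y} y≢x rewrite cas-a y | ≡ᵇ-false x y (λ e → y≢x (sym e)) = ∨-identityʳ (K y)
        F₀-x : F₀ x ≢ true
        F₀-x h = ff≢tt (trans (sym (freeSeq-substSeq-self x `0 (Γ ⇒ δ) refl))
                   (trans (sym (cong (freeIn x) e₀)) (proj₂ (∧-true (F x) h))))
        left = walk t₀ F₀ K′ e₀ (λ {y} h → trans (sym (cong (freeIn y) e₀)) (proj₂ (∧-true (F y) h)))
                 (inv-step inv i₀)
        right = walk t₁ F₁ K′ e₁ (λ {y} h → trans (sym (cong (freeIn y) e₁)) (proj₂ (∧-true (F y) h)))
                  (inv-step inv i₁)
        -- `x` is not free in the zero premise, so no hypothesis that remains available there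
        -- contains `x`, and putting 0 for `x` leaves each of them unchanged.
        zeroCtx : A₀ ⊆ map (substF x `0) A
        zeroCtx {χ} i = subst (_∈ map (substF x `0) A)
          (substF-fresh x `0 χ (¬true⇒false λ h → F₀-x (free-available x [] ρ₀ F₀ K′ (λ ()) i h)))
          (∈-map⁺ (substF x `0) (available-mono [] ρ₀ (λ {y} h → proj₁ (∧-true (F y) h))
            (λ {y} h → K′-other (λ { refl → F₀-x h })) i))
        sucCtx : ∀ {χ} → χ ∈ A₁ → map (substF x (`S (var x))) A ⊢ χ
        sucCtx = available-case x [] ρ₀ (λ ()) (λ {y} h → proj₁ (∧-true (F y) h)) K′-other
          (∨-trueʳ (K x) (trans (cas-a x) (≡ᵇ-refl x)))
          (λ i → assume (∈-map⁺ (substF x (`S (var x))) i))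
        reorder : ΓS ++ A₁ ⊆ A₁ ++ ΓS ++ map (substF x (`S (var x))) A
        reorder i with ∈-++⁻ ΓS i
        ... | inj₁ j = ∈-++⁺ʳ A₁ (∈-++⁺ˡ j)
        ... | inj₂ j = ∈-++⁺ˡ j

      walks : ∀ {ps} (ts : All PT ps) {a} F K → (∀ x → cas x a ≡ false) → Inv a F K → Children a ts →
              All (λ p → ctx p ++ available [] ρ₀ F K ⊢ goal p) ps
      walks [] F K k inv ch = []
      walks (_∷_ {x = p} t ts) {a} F K k inv ch with ch 0 refl
      ... | b , i , e =
          weaken (++⁺ (⊆-refl {x = ctx p}) (available-mono [] ρ₀ (λ {y} h → proj₁ (∧-true (F y) h)) (λ {y} _ → same y)))
            (walk t (λ y → F y ∧ free y b) (λ y → K y ∨ cas y a) e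
              (λ {y} h → trans (sym (cong (freeIn y) e)) (proj₂ (∧-true (F y) h))) (inv-step inv i))
        ∷ walks ts F K k inv (λ j → ch (suc j))
        where
        same : ∀ y → K y ∨ cas y a ≡ K y
        same y rewrite k y = ∨-identityʳ (K y)

  -- Serves the buds whose descent is `lower`: the companion's claim has already been derived from
  -- the hypotheses of the levels outside the one where the rank drops.
  LowerDone : List Entry → Set
  LowerDone []            = ⊤
  LowerDone ((n , m) ∷ σ) = LowerDone σ ×
    (∀ {c n′ m′ ρ} → c ∈ companions → n′ < n → μ c ≡ σ ʳ++ ((n′ , m′) ∷ ρ) → full σ ⊢ seqImp c)

  LowerDone-prefix : ∀ ρ σ → LowerDone (ρ ʳ++ σ) → LowerDone σ
  LowerDone-prefix []      σ l = l
  LowerDone-prefix (e ∷ ρ) σ l = proj₁ (LowerDone-prefix ρ (e ∷ σ) l)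

  useHyp : ∀ X c x {Γ} → below (ψ X c) x (`S (var x)) ∈ Γ → Γ ⊢ seqImp c
  useHyp X c x {Γ} i = ψE X c (subst (Γ ⊢_) (substF-self x (ψ X c))
    (belowE (ψ X c) x (`S (var x)) (var x) (assume i) (s<Ss (var x))))

  -- Goes inward to the first decisive level. A kept level whose variable has passed a Case is
  -- decisive too: its hypothesis covers the companion, and the inner hypotheses are gone.
  discharge-bud : ∀ σ {ρ ρ′ F K c} → c ∈ companions → Descent F K ρ ρ′ → μ c ≡ σ ʳ++ ρ′ →
                  LowerDone (ρ ʳ++ σ) → ∀ {Γ} → full σ ⊆ Γ → available σ ρ F K ⊆ Γ → Γ ⊢ seqImp c
  discharge-bud σ c∈ (lower {n} {m = m} {ρ = ρ} l) e low i j =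
    weaken i (proj₂ (LowerDone-prefix ρ ((n , m) ∷ σ) low) c∈ l e)
  discharge-bud σ {F = F} {K} {c} c∈ (prog {n} {x} f k) e low i j rewrite f | k =
    useHyp (x ∷ vars σ) c x (j (hyps⁺ ((n , just x) ∷ σ) x (`S (var x)) c∈ e))
  discharge-bud σ c∈ (keep {n} {nothing} f d) e low i j =
    discharge-bud ((n , nothing) ∷ σ) c∈ d e low i j
  discharge-bud σ {F = F} {K} {c} c∈ (keep {n} {just x} f d) e low i j rewrite f refl with K x
  ... | true  = useHyp (x ∷ vars σ) c x (j (hyps⁺ ((n , just x) ∷ σ) x (`S (var x)) c∈ e))
  ... | false = discharge-bud ((n , just x) ∷ σ) c∈ d e low
    (λ l → both (∈-++⁻ H l)) (λ l → j (∈-++⁺ʳ H l))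
    where
    H = hyps ((n , just x) ∷ σ) x (var x)
    both : ∀ {χ} → (χ ∈ H) ⊎ (χ ∈ full σ) → χ ∈ _
    both (inj₁ l) = j (∈-++⁺ˡ l)
    both (inj₂ l) = i l

  module Leaf (c : Address) (low : LowerDone (μ c ʳ++ [])) where

    -- The start is a separate alternative because `Descent` is not reflexive; there `F` has to
    -- contain the free names for the first edge to be recorded.
    Inv : Address → (F K : ℕ → Bool) → Set
    Inv a F K = ((μ a ≡ μ c) × (∀ {x} → free x a ≡ true → F x ≡ true)) ⊎ Descent F K (μ c) (μ a)

    inv-step : ∀ {a b F K} → Inv a F K → (a , b) ∈ edges →
               Inv b (λ x → F x ∧ free x b) (λ x → K x ∨ cas x a)
    inv-step {a} {b} {F} {K} (inj₁ (e , f)) i = inj₂ (subst (λ ρ → Descent _ _ ρ (μ b)) e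
      (Descent-mono (λ {x} h → let h₁ , h₂ = ∧-true (free x a) h in ∧-intro (f h₁) h₂)
                    (λ {x} h → ∨-trueʳ (K x) h) (step-descent i)))
    inv-step {a} {b} {F} {K} (inj₂ d) i = inj₂ (Descent-trans
      (λ {x} f g → ∧-intro f (proj₂ (∧-true (free x a) g))) (λ h → ∨-trueˡ _ h) (λ {x} h → ∨-trueʳ (K x) h)
      d (step-descent i))

    inv-bud : ∀ {a s c′ F K} → Inv a F K → sub π a ≡ just (s , bud s c′) →
              available [] (μ c) F K ⊢ seqImp c′
    inv-bud {a} {s} {c′} {F} {K} inv e =
      discharge-bud [] (companion⁺ {a} {s} {c′} e) (descent inv) refl low (λ ()) (λ i → i)
      where
      noCase : ∀ {x} {A : Set} → cas x a ≡ true → A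
      noCase {x} h = ff≢tt (trans (sym (cong (caseIn x) e)) h)
      descent : Inv a F K → Descent F K (μ c) (μ c′)
      descent (inj₁ (e′ , f)) = subst (λ ρ → Descent F K ρ (μ c′)) e′
        (Descent-mono (λ {x} h → f (proj₁ (∧-true (free x a) h))) noCase (step-descent (edge⁺ e (here refl))))
      descent (inj₂ d) = Descent-trans (λ f _ → f) (λ k → k) noCase d (step-descent (edge⁺ e (here refl)))

    open Walk (μ c) Inv inv-step inv-bud

    leaf : c ∈ companions → full (μ c ʳ++ []) ⊢ seqImp c
    leaf c∈ with companion⁻ c∈
    ... | t , e , _ = ⊃I (cutAll (ctx (seqAt c)) (λ i → ⋀E (ctx (seqAt c)) hyp₀ i)
        (weaken (++⁺ (⊆-refl {x = ctx (seqAt c)}) (λ i → there (available⊆full (μ c) [] F₀ i)))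
          (walk t F₀ (λ _ → false) e (λ {x} h → trans (sym (cong (freeIn x) e)) h) (inj₁ (refl , λ h → h)))))
      where
      F₀ : ℕ → Bool
      F₀ x = free x c

  distinct-ʳ++ : ∀ c σ {n x ρ} → μ c ≡ σ ʳ++ ((n , just x) ∷ ρ) → x ∉ vars σ
  distinct-ʳ++ c σ e i = distinct c (reverse σ) (trans e (ʳ++-defn σ)) (∈-vars-reverse σ i)

  length-suffix : ∀ c σ {ρ k} → length σ + k ≡ D → μ c ≡ σ ʳ++ ρ → length ρ ≡ k
  length-suffix c σ h e = +-cancelˡ-≡ (length σ) _ _
    (trans (sym (length-ʳ++ σ)) (trans (cong length (sym e)) (trans (len c) (sym h))))

  -- The recursion is on the number `k` of levels still to be entered, and within a level on the
  -- rank. For `k` = 0 the prefix is the companion's whole stack, and the subtree at the companion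
  -- is traversed.
  group-derivable : ∀ k σ → length σ + k ≡ D → LowerDone σ →
    ∀ {c ρ} → c ∈ companions → μ c ≡ σ ʳ++ ρ → full σ ⊢ ψ (vars σ) c
  group-derivable zero σ h low {c} {[]} c∈ e =
    ψI (vars σ) c (λ z → free-full z σ) (subst (λ τ → full τ ⊢ seqImp c) rev
      (Leaf.leaf c (subst LowerDone (sym rev) low) c∈))
    where
    rev : μ c ʳ++ [] ≡ σ
    rev = trans (cong (_ʳ++ []) e) (trans (ʳ++-ʳ++ σ) (++-identityʳ σ))
  group-derivable zero σ h low {c} {_ ∷ _} c∈ e with length-suffix c σ h e
  ... | ()
  group-derivable (suc k) σ h low {c} {[]} c∈ e with length-suffix c σ h e
  ... | ()
  group-derivable (suc k) σ h low {c} {(n , m) ∷ ρ} c∈ e = <-rec Goal byRank n c∈ e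
    where
    Goal : ℕ → Set
    Goal n = ∀ {c m ρ} → c ∈ companions → μ c ≡ σ ʳ++ ((n , m) ∷ ρ) → full σ ⊢ ψ (vars σ) c
    byRank : ∀ n → (∀ {n′} → n′ < n → Goal n′) → Goal n
    byRank n below′ {c} {m} c∈ e = byVar m e
      where
      h′ : suc (length σ) + k ≡ D
      h′ = trans (sym (+-suc (length σ) k)) h
      low′ : ∀ m → LowerDone ((n , m) ∷ σ)
      low′ m = low , λ {c′} i l e′ → ψE (vars σ) c′ (below′ l i e′)
      byVar : ∀ m {ρ} → μ c ≡ σ ʳ++ ((n , m) ∷ ρ) → full σ ⊢ ψ (vars σ) c
      byVar nothing  e = group-derivable k ((n , nothing) ∷ σ) h′ (low′ nothing) c∈ e
      -- The induction treats `x` as a parameter; afterwards the implication is closed again over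
      -- the names outside `vars σ`, which does not contain `x`.
      byVar (just x) e = ψI (vars σ) c (λ z → free-full z σ) (ψE (vars σ′) c
          (mutualInduction (full σ) x S
            (¬true⇒false λ f → distinct-ʳ++ c σ e (free-full x σ f))
            (All.tabulate Pi-S) premises (∈-map⁺ (ψ (vars σ′)) (group⁺ σ′ c∈ e))))
        where
        σ′ = (n , just x) ∷ σ
        S = map (ψ (vars σ′)) (group σ′)
        Pi-S : ∀ {φ} → φ ∈ S → Pi (ImpSet Θ) φ
        Pi-S i with ∈-map⁻ (ψ (vars σ′)) i
        ... | c′ , j , refl = Pi-ψ (vars σ′) (proj₁ (group⁻ σ′ j))
        -- This context is `full σ′` by definition, so the premises of the induction are the claims
        -- one level further in.
        premises : ∀ {φ} → φ ∈ S → belows x S (var x) ++ full σ ⊢ φ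
        premises i with ∈-map⁻ (ψ (vars σ′)) i
        ... | c′ , j , refl with group⁻ σ′ j
        ...   | c′∈ , ρ′ , e′ = group-derivable k σ′ h′ (low′ (just x)) c′∈ e′

  -- With the empty stack there are no hypotheses: every bud is discharged by the closed claim of
  -- its companion, and the tree above the buds is translated rule by rule.
  derivation : ctx s₀ ++ [] ⊢ goal s₀
  derivation = walk π {[]} (λ _ → false) (λ _ → false) refl (λ ()) tt
    where
    open Walk [] (λ _ _ _ → ⊤) (λ _ _ → tt)
      (λ {a} {s} {c} _ e → ψE [] c (group-derivable D [] refl tt (companion⁺ {a} {s} {c} e) refl))

theorem6p5 : (Θ : Formula 0 → Set) (s : Seq) (π : PT s) →
    CHAProof π → BudsCompanionsIn Θ π →
    HAProof (λ φ → Pi (ImpSet Θ) φ ⊎ Δ0 φ) s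
theorem6p5 Θ s π cha inΘ with StepGraph.stacks π cha
... | D , μ , len , desc , dist = subst (λ Γ → HAProof _ (Γ ⇒ goal s)) (++-identityʳ (ctx s))
  (Translation.derivation Θ π (proj₁ cha) inΘ D μ len desc dist)
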